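{- There exists a homomorphism of commutative $\mathbb{Q}$-algebras $\tau:\mathrm{QSym}\to\mathrm{Sym}_{\mathbb{Q}}[q,t]$ such that $\tau(\mathcal{G}[{\bf X}])=\mathcal{H}[{\bf X}](q,t)$ for every polymatroid ${\bf X}$.
   Context: A polymatroid is ${\bf X}=(X,\operatorname{rk})$, $X$ finite, $\operatorname{rk}$ from subsets of $X$ to $\{0,1,2,\dots\}$ with $\operatorname{rk}(\emptyset)=0$, monotone and submodular; ${\bf X}|_A=(A,\operatorname{rk}|_A)$. $\mathrm{Sym}=\mathbb{Z}[e_1,e_2,\dots]$ is the graded ring of symmetric functions with Schur basis $s_\lambda$, $\overline{\mathrm{Sym}}=\mathbb{Z}[[e_1,e_2,\dots]]$, $\sigma=1+s_1+s_2+\cdots$, and $\mathrm{Sym}_{\mathbb{Q}}[q,t]=\mathbb{Q}[q,t]\otimes_{\mathbb{Z}}\mathrm{Sym}$. $\mathcal{P}[{\bf X}]$ is defined recursively: $\mathcal{P}[{\bf X}]=1$ if $X=\emptyset$; otherwise it is the sum of the homogeneous components of degrees $0,\dots,|X|-1$ of $-\sum_{A\subsetneq X}\mathcal{P}[{\bf X}|_A]\sigma^{\operatorname{rk}(X)-\operatorname{rk}(A)}(-1)^{|X|-|A|}$. $\mathcal{H}[{\bf X}](q,t)=\sum_{A\subseteq X}\mathcal{P}[{\bf X}|_A]q^{\operatorname{rk}(A)}t^{|A|}$. $\mathrm{QSym}$ is the $\mathbb{Q}$-algebra of quasi-symmetric functions with basis $P_\alpha$ ($\alpha$ finite sequences of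 positive integers, including the empty one, $P_{()}=1$), multiplied by $P_\alpha P_\beta=\sum_\gamma P_\gamma$, the sum over all $\binom{\ell(\alpha)+\ell(\beta)}{\ell(\alpha)}$ shuffles $\gamma$ of $\alpha$ and $\beta$ (here $\ell$ is the length); $P_\alpha$ is the basis dual to the monomials $p_{\alpha_1}\cdots p_{\alpha_r}$ of $\mathbb{Q}\langle p_1,p_2,\dots\rangle$ with all $p_i$ primitive. For a sequence $a=(a_1,\dots,a_d)$ of nonnegative integers set $U_a=P_{(a_1+1,\dots,a_d+1)}$. For a polymatroid with $|X|=d$, $\mathcal{G}[{\bf X}]=\sum_{\underline X}U_{r(\underline X)}$ over all maximal chains $\underline X:\emptyset=X_0\subset X_1\subset\cdots\subset X_d=X$ with $|X_i|=i$, where $r(\underline X)=(\operatorname{rk}(X_1)-\operatorname{rk}(X_0),\dots,\operatorname{rk}(X_d)-\operatorname{rk}(X_{d-1}))$. -}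

module Defs where

open import Data.Nat using (ℕ; zero; suc; _+_; _*_; _∸_; _≤_; _≡ᵇ_; _≤ᵇ_)
open import Data.Bool using (Bool; true; false; _∧_; _∨_; not; if_then_else_)
open import Data.Rational using (ℚ; 0ℚ; 1ℚ) renaming (_+_ to _+ℚ_; _*_ to _*ℚ_; -_ to -ℚ_)
open import Data.List using (List; []; _∷_; _++_; map; concatMap; filter; foldr; replicate)
open import Data.Product using (_×_; _,_)
open import Data.Vec using (Vec; []; _∷_; _[_]≔_; lookup)
open import Data.Fin using (Fin)
open import Data.Fin.Subset using (Subset; ⊥; ⊤; _⊆_; _∪_; _∩_; ∣_∣; inside; outside)
open import Data.List using (allFin) renaming (filter to filterL)
open import Relation.Nullary.Decidable using (does)
open import Relation.Binary.PropositionalEquality using (_≡_)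
open import Data.Bool.Properties using () renaming (T? to T?)
open import Data.Bool using (T)

record IsPolymatroid {n : ℕ} (rk : Subset n → ℕ) : Set where
  field
    rk-empty      : rk ⊥ ≡ 0
    rk-monotone   : ∀ A B → A ⊆ B → rk A ≤ rk B
    rk-submodular : ∀ A B → rk (A ∪ B) + rk (A ∩ B) ≤ rk A + rk B

-- Sym_ℚ[q,t] = ℚ[q, t, e₁, e₂, …] (polynomial ring; Sym = ℤ[e₁,e₂,…] ⊆ it)
-- A monomial is a list of exponents (missing trailing entries are 0):
-- position 0 ↦ q, position 1 ↦ t, position 2+j ↦ e_{j+1}.

Mono : Set
Mono = List ℕ

SymQT : Set
SymQT = List (ℚ × Mono)

monoEq : Mono → Mono → Bool
monoEq []       []       = true
monoEq []       (y ∷ ys) = (y ≡ᵇ 0) ∧ monoEq [] ys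
monoEq (x ∷ xs) []       = (x ≡ᵇ 0) ∧ monoEq xs []
monoEq (x ∷ xs) (y ∷ ys) = (x ≡ᵇ y) ∧ monoEq xs ys

monoMul : Mono → Mono → Mono
monoMul []       ys       = ys
monoMul (x ∷ xs) []       = x ∷ xs
monoMul (x ∷ xs) (y ∷ ys) = (x + y) ∷ monoMul xs ys

coeff : SymQT → Mono → ℚ
coeff []             m = 0ℚ
coeff ((c , m') ∷ p) m = (if monoEq m' m then c else 0ℚ) +ℚ coeff p m

infix 4 _≈_
_≈_ : SymQT → SymQT → Set
p ≈ q = ∀ m → coeff p m ≡ coeff q m

infixl 6 _⊕_
infixl 7 _⊗_
_⊕_ : SymQT → SymQT → SymQT
p ⊕ q = p ++ q

_⊗_ : SymQT → SymQT → SymQT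
p ⊗ q = concatMap (λ { (c , m) → map (λ { (d , m') → (c *ℚ d , monoMul m m') }) q }) p

scale : ℚ → SymQT → SymQT
scale c p = map (λ { (d , m) → (c *ℚ d , m) }) p

neg : SymQT → SymQT
neg = scale (-ℚ 1ℚ)

𝟙 : SymQT
𝟙 = (1ℚ , []) ∷ []

𝟘 : SymQT
𝟘 = []

pow : SymQT → ℕ → SymQT
pow p zero    = 𝟙
pow p (suc k) = p ⊗ pow p k

sumP : List SymQT → SymQT
sumP = foldr _⊕_ 𝟘

sign : ℕ → SymQT
sign zero    = 𝟙
sign (suc k) = neg (sign k)

qv tv : SymQT
qv = (1ℚ , 1 ∷ []) ∷ []
tv = (1ℚ , 0 ∷ 1 ∷ []) ∷ []

e : ℕ → SymQT
e zero    = 𝟙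
e (suc j) = (1ℚ , replicate (2 + j) 0 ++ (1 ∷ [])) ∷ []

degE : Mono → ℕ
degE []               = 0
degE (_ ∷ [])         = 0
degE (_ ∷ _ ∷ es)     = go 1 es
  where
  go : ℕ → List ℕ → ℕ
  go i []       = 0
  go i (k ∷ ks) = i * k + go (suc i) ks

trunc : ℕ → SymQT → SymQT
trunc d = filterL (λ { (c , m) → T? (degE m ≤ᵇ d) })

-- complete homogeneous functions h_k = s_(k) (one-row Schur functions),
-- via  h_k = Σ_{i=1}^{k} (-1)^{i-1} e_i h_{k-i},  h_0 = 1.
-- hsRev k = h_k ∷ h_{k-1} ∷ … ∷ h_0 ∷ []
private
  step : ℕ → List SymQT → SymQT
  step i []       = 𝟘
  step i (h ∷ hs) = sign i ⊗ e (suc i) ⊗ h ⊕ step (suc i) hs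

hsRev : ℕ → List SymQT
hsRev zero    = 𝟙 ∷ []
hsRev (suc k) = step 0 (hsRev k) ∷ hsRev k

s : ℕ → SymQT
s k with hsRev k
... | []    = 𝟘
... | h ∷ _ = h

σ≤ : ℕ → SymQT
σ≤ zero    = 𝟙
σ≤ (suc d) = σ≤ d ⊕ s (suc d)

allSubsets : (n : ℕ) → List (Subset n)
allSubsets zero    = [] ∷ []
allSubsets (suc n) = map (inside ∷_) (allSubsets n) ++ map (outside ∷_) (allSubsets n)

⊆ᵇ : ∀ {n} → Subset n → Subset n → Bool
⊆ᵇ []       []       = true
⊆ᵇ (x ∷ xs) (y ∷ ys) = (not x ∨ y) ∧ ⊆ᵇ xs ys

eqᵇ : ∀ {n} → Subset n → Subset n → Bool
eqᵇ []       []       = true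
eqᵇ (x ∷ xs) (y ∷ ys) = (if x then y else not y) ∧ eqᵇ xs ys

properSubsets : ∀ {n} → Subset n → List (Subset n)
properSubsets {n} A = filterL (λ B → T? (⊆ᵇ B A ∧ not (eqᵇ B A))) (allSubsets n)

-- 𝒫[X|_A] for A ⊆ X = Fin n, by recursion with fuel (fuel ≥ ∣A∣ suffices).
-- For ∣A∣ ≥ 1, the degree ≤ ∣A∣-1 part of a product only involves the degree
-- ≤ ∣A∣-1 part of σ, so σ is replaced by σ≤ (∣A∣ ∸ 1).

Pfun : ∀ {n} → (Subset n → ℕ) → ℕ → Subset n → SymQT
Pfun rk zero    A = 𝟙
Pfun rk (suc f) A with ∣ A ∣
... | zero  = 𝟙
... | suc d = trunc d (neg (sumP (map term (properSubsets A))))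
  where
  term : _ → SymQT
  term B = Pfun rk f B ⊗ pow (σ≤ d) (rk A ∸ rk B) ⊗ sign (suc d ∸ ∣ B ∣)

𝒫 : ∀ {n} → (Subset n → ℕ) → Subset n → SymQT
𝒫 {n} rk A = Pfun rk n A

ℋ : ∀ {n} → (Subset n → ℕ) → SymQT
ℋ {n} rk = sumP (map (λ A → 𝒫 rk A ⊗ pow qv (rk A) ⊗ pow tv ∣ A ∣) (allSubsets n))

-- QSym (over ℚ) with basis P_α.
-- Encoding: a code a = (a₁,…,a_d) : List ℕ stands for the composition
-- (a₁+1,…,a_d+1); so the basis element with code a is exactly U_a,
-- and every composition (incl. the empty one) has exactly one code.

Comp : Set
Comp = List ℕ

QSym : Set
QSym = List (ℚ × Comp)

shuffles : Comp → Comp → List Comp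
shuffles []       ys       = ys ∷ []
shuffles (x ∷ xs) []       = (x ∷ xs) ∷ []
shuffles (x ∷ xs) (y ∷ ys) =
  map (x ∷_) (shuffles xs (y ∷ ys)) ++ map (y ∷_) (shuffles (x ∷ xs) ys)

-- A ℚ-linear map QSym → Sym_ℚ[q,t] is given by its values on the basis;
-- it is a homomorphism of ℚ-algebras iff it is unital and multiplicative on
-- the basis (P_α P_β = Σ_{γ ∈ shuffles α β} P_γ).
record IsAlgHomOnBasis (f : Comp → SymQT) : Set where
  field
    unital : f [] ≈ 𝟙
    mult   : ∀ α β → f α ⊗ f β ≈ sumP (map f (shuffles α β))

extend : (Comp → SymQT) → QSym → SymQT
extend f x = sumP (map (λ { (c , α) → scale c (f α) }) x)

-- 𝒢[X] = Σ over maximal chains of U_{r(chain)}.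
-- A maximal chain ∅ = X₀ ⊂ X₁ ⊂ ⋯ ⊂ X_n = X is built by adding one new
-- element at each step; rseqs lists the rank-increment sequences r of all
-- maximal chains from A up to the full set (one entry per chain).

rseqs : ∀ {n} → (Subset n → ℕ) → ℕ → Subset n → List (List ℕ)
rseqs rk zero    A = [] ∷ []
rseqs {n} rk (suc f) A =
  concatMap (λ i → if lookup A i then []
                   else map ((rk (A [ i ]≔ inside) ∸ rk A) ∷_) (rseqs rk f (A [ i ]≔ inside)))
            (allFin n)

𝒢 : ∀ {n} → (Subset n → ℕ) → QSym
𝒢 {n} rk = map (λ r → (1ℚ , r)) (rseqs rk n ⊥)

{-# OPTIONS --safe #-}

-- Both 𝒫 and ℋ are sums over maximal chains, depending on a chain only
-- through its sequence r of rank increments: 𝒫[X] = Σ π(r), where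
--   π(r) = − (part of degree < ℓ(r) of Σ π(r₁) χ(r₂), over r = r₁ r₂ with r₂ ≠ ()),
--   χ(r) = (−1)^ℓ(r) σ^|r| / ℓ(r)!,
-- because an interval of length k contains k! chains.  For the same reason
-- ℋ[X] = Σ τ(r), where τ is the convolution (with respect to
-- deconcatenation) of q^|r| t^ℓ(r) π(r) with 1/ℓ(r)!.  Convolutions of
-- characters of the shuffle algebra are characters, and χ, 1/ℓ! are
-- characters, so it remains to see that π is one.  This is a Birkhoff
-- factorisation: π(r) has degree < ℓ(r) while (π ⋆ χ)(r) has degree ≥ ℓ(r),
-- and by induction π(a)π(b) − π(a ш b) equals
-- (π ⋆ χ)(a)(π ⋆ χ)(b) − (π ⋆ χ)(a ш b), so it satisfies both bounds and vanishes.

module Submission where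

open import Defs using (Comp; shuffles; eqᵇ; ⊆ᵇ; allSubsets; properSubsets; rseqs)
open import Level using (0ℓ)
open import Algebra.Bundles using (CommutativeRing)
open import Data.Bool.Base using (Bool; true; false; if_then_else_; not; _∧_)
open import Data.Bool.Properties using (T?; T-≡)
open import Data.Fin.Base using (Fin; zero; suc)
open import Data.Fin.Subset using (Subset; ⊥; ⊤; _⊆_; ∣_∣; inside)
open import Data.Fin.Subset.Properties using (∣⊥∣≡0; ∣⊤∣≡n; ∣p∣≡n⇒p≡⊤; ∣p∣≤n)
open import Data.List.Base using (List; []; _∷_; _++_; map; length; concatMap; foldr; filter; allFin; replicate)
open import Data.List.Properties using (++-assoc; ++-identityʳ; map-cong; map-tabulate; length-++; length-map)
open import Data.List.Relation.Unary.All as All using (All; []; _∷_)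
import Data.List.Relation.Unary.All.Properties as All
open import Data.Nat.Base as ℕ using (ℕ; zero; suc; _≤_; _<_; z≤n; s≤s; s≤s⁻¹; _!; _∸_; _≤ᵇ_; _≡ᵇ_)
open import Data.Nat.ListAction using (sum)
import Data.Nat.Properties as ℕ
import Data.Nat.Tactic.RingSolver as ℕ-Solver
open import Data.Product.Base as Product using (_,_; proj₁; proj₂)
open import Data.Rational.Base as ℚ using (ℚ; 0ℚ; 1ℚ)
import Data.Rational.Properties as ℚ
import Data.Unit.Base as Unit
open import Data.Vec.Base using ([]; _∷_; lookup; _[_]≔_; here; there)
open import Function.Base using (_∘_)
open import Function.Bundles using (Equivalence)
open import Relation.Binary.PropositionalEquality as ≡ using (_≡_; cong; cong₂; subst)
open import Relation.Nullary.Decidable.Core using (dec⇒maybe)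
open import Relation.Nullary.Negation.Core using (contradiction)
open import Tactic.RingSolver using (solve-∀)
open import Tactic.RingSolver.Core.AlmostCommutativeRing using (AlmostCommutativeRing; fromCommutativeRing)

-- The series σ is not a polynomial, so χ becomes a family `χ N` built from truncations of σ. Each
-- `χ N` is an exact character; different N agree only in low degrees, which is all that the
-- recursion for π sees. A word of length d + 1 uses `χ d`, but multiplicativity needs one N for two
-- words and all their shuffles, hence the stability hypothesis. The equality of the two differences
-- comes from expanding that of π ⋆ χ over pairs of splits: each pair contributes the difference for
-- π on the first parts times the sum of χ over the shuffles of the second parts. By induction only
-- the pair with both second parts empty survives. The clash of bounds uses no more than this: upper
-- bounds on degrees add under multiplication, and so do lower bounds. The factorisation therefore
-- takes place in any commutative ring with suitable truncation maps; lists of terms, which are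
-- equal only up to coefficients, enter at the end. The bound on the degree of π fails for the empty
-- word, where π is 1, so empty words are treated apart.

splits : Comp → List (Comp Product.× Comp)
splits []      = ([] , []) ∷ []
splits (x ∷ r) = ([] , x ∷ r) ∷ map (λ s → x ∷ proj₁ s , proj₂ s) (splits r)

-- Lengths and number of shuffles

shuffles-length : ∀ a b → All (λ c → length c ≡ length a ℕ.+ length b) (shuffles a b)
shuffles-length []      b       = ≡.refl ∷ []
shuffles-length (x ∷ a) []      = ≡.sym (ℕ.+-identityʳ _) ∷ []
shuffles-length (x ∷ a) (y ∷ b) = All.++⁺
  (All.map⁺ (All.map (cong suc) (shuffles-length a (y ∷ b))))
  (All.map⁺ (All.map (λ eq → cong suc (≡.trans eq (≡.sym (ℕ.+-suc _ _)))) (shuffles-length (x ∷ a) b)))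

-- Pascal's rule for the binomial coefficient, with denominators cleared: the shuffles are sorted by
-- the word that supplies the first letter.
length-shuffles : ∀ a b → length (shuffles a b) ℕ.* (length a ! ℕ.* length b !) ≡ (length a ℕ.+ length b) !
length-shuffles []      b       = ≡.trans (ℕ.+-identityʳ _) (ℕ.*-identityˡ _)
length-shuffles (x ∷ a) []      = ≡.trans (ℕ.*-identityˡ _)
  (≡.trans (ℕ.*-identityʳ (length (x ∷ a) !)) (cong _! (≡.sym (ℕ.+-identityʳ (length (x ∷ a))))))
length-shuffles (x ∷ a) (y ∷ b) = begin
  length (map (x ∷_) S ++ map (y ∷_) S') ℕ.* (A ! ℕ.* B !)
    ≡⟨ cong (ℕ._* (A ! ℕ.* B !)) (≡.trans (length-++ (map (x ∷_) S)) (cong₂ ℕ._+_ (length-map _ S) (length-map _ S'))) ⟩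
  (length S ℕ.+ length S') ℕ.* ((A ℕ.* length a !) ℕ.* (B ℕ.* length b !))
    ≡⟨ rearrange (length S) (length S') A (length a !) B (length b !) ⟩
  A ℕ.* (length S ℕ.* (length a ! ℕ.* B !)) ℕ.+ B ℕ.* (length S' ℕ.* (A ! ℕ.* length b !))
    ≡⟨ cong₂ (λ u v → A ℕ.* u ℕ.+ B ℕ.* v) (≡.trans (length-shuffles a (y ∷ b)) (cong _! (ℕ.+-suc (length a) (length b)))) (length-shuffles (x ∷ a) b) ⟩
  A ℕ.* suc (length a ℕ.+ length b) ! ℕ.+ B ℕ.* suc (length a ℕ.+ length b) !
    ≡⟨ ℕ.*-distribʳ-+ (suc (length a ℕ.+ length b) !) A B ⟨
  (A ℕ.+ B) ℕ.* suc (length a ℕ.+ length b) !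
    ≡⟨ cong (λ n → suc n ℕ.* suc (length a ℕ.+ length b) !) (ℕ.+-suc (length a) (length b)) ⟩
  suc (suc (length a ℕ.+ length b)) !
    ≡⟨ cong (λ n → suc n !) (ℕ.+-suc (length a) (length b)) ⟨
  (A ℕ.+ B) !
    ∎
  where
  open ≡.≡-Reasoning
  A = suc (length a)
  B = suc (length b)
  S = shuffles a (y ∷ b)
  S' = shuffles (x ∷ a) b
  rearrange : ∀ m n a a' b b' → (m ℕ.+ n) ℕ.* ((a ℕ.* a') ℕ.* (b ℕ.* b'))
                              ≡ a ℕ.* (m ℕ.* (a' ℕ.* (b ℕ.* b'))) ℕ.+ b ℕ.* (n ℕ.* ((a ℕ.* a') ℕ.* b'))
  rearrange = ℕ-Solver.solve-∀

-- Finite sums and additive maps in a commutative ring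

module Sums (R : CommutativeRing 0ℓ 0ℓ) where
  open CommutativeRing R public hiding (_-_; zero)
  open import Algebra.Properties.Ring ring public using (-‿+-comm; -‿distribˡ-*)
  open import Algebra.Properties.Semiring.Exp semiring public using (_^_; ^-homo-*)
  open import Algebra.Properties.Semiring.Mult semiring public using (_×_; ×-congʳ; ×-congˡ; ×-assocˡ; ×-assoc-*; ×-comm-*)
  open import Algebra.Properties.CommutativeSemigroup *-commutativeSemigroup public using () renaming (interchange to *-interchange)
  open import Algebra.Properties.CommutativeSemigroup +-commutativeSemigroup public using () renaming (interchange to +-interchange)
  open import Relation.Binary.Reasoning.Setoid setoid public

  open import Algebra.Solver.Ring.NaturalCoefficients.Default commutativeSemiring public using (solve; _:=_; _:+_; _:*_)

  ∑ : {A : Set} → List A → (A → Carrier) → Carrier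
  ∑ xs f = foldr _+_ 0# (map f xs)

  ∑-congᵃ : ∀ {A} {f g : A → Carrier} {xs} → All (λ x → f x ≈ g x) xs → ∑ xs f ≈ ∑ xs g
  ∑-congᵃ []         = refl
  ∑-congᵃ (eq ∷ eqs) = +-cong eq (∑-congᵃ eqs)

  ∑-cong : ∀ {A} (xs : List A) {f g : A → Carrier} → (∀ x → f x ≈ g x) → ∑ xs f ≈ ∑ xs g
  ∑-cong xs eq = ∑-congᵃ (All.universal eq xs)

  ∑-0 : ∀ {A} (xs : List A) → ∑ xs (λ _ → 0#) ≈ 0#
  ∑-0 []       = refl
  ∑-0 (x ∷ xs) = trans (+-identityˡ _) (∑-0 xs)

  ∑-+ : ∀ {A} (xs : List A) (f g : A → Carrier) → ∑ xs (λ x → f x + g x) ≈ ∑ xs f + ∑ xs g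
  ∑-+ []       f g = sym (+-identityˡ 0#)
  ∑-+ (x ∷ xs) f g = trans (+-congˡ (∑-+ xs f g)) (+-interchange (f x) (g x) _ _)

  ∑-*ˡ : ∀ {A} (xs : List A) c (f : A → Carrier) → ∑ xs (λ x → c * f x) ≈ c * ∑ xs f
  ∑-*ˡ []       c f = sym (zeroʳ c)
  ∑-*ˡ (x ∷ xs) c f = trans (+-congˡ (∑-*ˡ xs c f)) (sym (distribˡ c _ _))

  ∑-*ʳ : ∀ {A} (xs : List A) c (f : A → Carrier) → ∑ xs (λ x → f x * c) ≈ ∑ xs f * c
  ∑-*ʳ xs c f = trans (∑-cong xs (λ x → *-comm (f x) c)) (trans (∑-*ˡ xs c f) (*-comm c _))

  ∑-swap : ∀ {A B} (xs : List A) (ys : List B) (f : A → B → Carrier) →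
           ∑ xs (λ x → ∑ ys (f x)) ≈ ∑ ys (λ y → ∑ xs (λ x → f x y))
  ∑-swap []       ys f = sym (∑-0 ys)
  ∑-swap (x ∷ xs) ys f = trans (+-congˡ (∑-swap xs ys f)) (sym (∑-+ ys (f x) _))

  ∑-*-∑ : ∀ {A B} (xs : List A) (ys : List B) (f : A → Carrier) (g : B → Carrier) →
          ∑ xs f * ∑ ys g ≈ ∑ xs (λ x → ∑ ys (λ y → f x * g y))
  ∑-*-∑ xs ys f g = trans (sym (∑-*ʳ xs _ f)) (∑-cong xs (λ x → sym (∑-*ˡ ys (f x) g)))

  ∑-++ : ∀ {A} (xs ys : List A) (f : A → Carrier) → ∑ (xs ++ ys) f ≈ ∑ xs f + ∑ ys f
  ∑-++ []       ys f = sym (+-identityˡ _)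
  ∑-++ (x ∷ xs) ys f = trans (+-congˡ (∑-++ xs ys f)) (sym (+-assoc _ _ _))

  ∑-map : ∀ {A B} (g : A → B) (xs : List A) (f : B → Carrier) → ∑ (map g xs) f ≡ ∑ xs (f ∘ g)
  ∑-map g []       f = ≡.refl
  ∑-map g (x ∷ xs) f = cong (f (g x) +_) (∑-map g xs f)

  ∑-concatMap : ∀ {A B} (g : A → List B) (xs : List A) (f : B → Carrier) →
                ∑ (concatMap g xs) f ≈ ∑ xs (λ x → ∑ (g x) f)
  ∑-concatMap g []       f = refl
  ∑-concatMap g (x ∷ xs) f = trans (∑-++ (g x) (concatMap g xs) f) (+-congˡ (∑-concatMap g xs f))

  ∑-const : ∀ {A} (xs : List A) c → ∑ xs (λ _ → c) ≈ length xs × c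
  ∑-const []       c = refl
  ∑-const (x ∷ xs) c = +-congˡ (∑-const xs c)

  -- Covers truncation, negation and multiplication by a constant, all of which have to be moved
  -- through sums over chains.
  record Additive (Φ : Carrier → Carrier) : Set where
    field
      Φ-cong : ∀ {x y} → x ≈ y → Φ x ≈ Φ y
      Φ-+    : ∀ x y → Φ (x + y) ≈ Φ x + Φ y

    Φ-0 : Φ 0# ≈ 0#
    Φ-0 = begin
      Φ 0#                          ≈⟨ +-identityʳ _ ⟨
      Φ 0# + 0#                     ≈⟨ +-congˡ (-‿inverseʳ (Φ 0#)) ⟨
      Φ 0# + (Φ 0# + - Φ 0#)        ≈⟨ +-assoc _ _ _ ⟨
      (Φ 0# + Φ 0#) + - Φ 0#        ≈⟨ +-congʳ (Φ-+ 0# 0#) ⟨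
      Φ (0# + 0#) + - Φ 0#          ≈⟨ +-congʳ (Φ-cong (+-identityˡ 0#)) ⟩
      Φ 0# + - Φ 0#                 ≈⟨ -‿inverseʳ (Φ 0#) ⟩
      0#                            ∎

    Φ-neg : ∀ x → Φ (- x) ≈ - Φ x
    Φ-neg x = begin
      Φ (- x)                       ≈⟨ +-identityʳ _ ⟨
      Φ (- x) + 0#                  ≈⟨ +-congˡ (-‿inverseʳ (Φ x)) ⟨
      Φ (- x) + (Φ x + - Φ x)       ≈⟨ +-assoc _ _ _ ⟨
      (Φ (- x) + Φ x) + - Φ x       ≈⟨ +-congʳ (Φ-+ (- x) x) ⟨
      Φ (- x + x) + - Φ x           ≈⟨ +-congʳ (trans (Φ-cong (-‿inverseˡ x)) Φ-0) ⟩
      0# + - Φ x                    ≈⟨ +-identityˡ _ ⟩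
      - Φ x                         ∎

    Φ-∑ : ∀ {A} (xs : List A) (f : A → Carrier) → Φ (∑ xs f) ≈ ∑ xs (Φ ∘ f)
    Φ-∑ []       f = Φ-0
    Φ-∑ (x ∷ xs) f = trans (Φ-+ _ _) (+-congˡ (Φ-∑ xs f))

-- Characters of the shuffle algebra

module Characters (R : CommutativeRing 0ℓ 0ℓ) where
  open Sums R

  infixr 5 _▷_
  -- The left derivative of f by the letter x. Shuffles, splits and chains are all recursive in the
  -- first letter, so the inductions below vary f and pass to its derivatives.
  _▷_ : ℕ → (Comp → Carrier) → Comp → Carrier
  (x ▷ f) r = f (x ∷ r)

  ∑ˢ : (Comp → Carrier) → Comp → Comp → Carrier
  ∑ˢ f a b = ∑ (shuffles a b) f

  ∑ˢ-[]ˡ : ∀ f b → ∑ˢ f [] b ≈ f b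
  ∑ˢ-[]ˡ f b = +-identityʳ _

  ∑ˢ-[]ʳ : ∀ f a → ∑ˢ f a [] ≈ f a
  ∑ˢ-[]ʳ f []      = +-identityʳ _
  ∑ˢ-[]ʳ f (x ∷ a) = +-identityʳ _

  ∑ˢ-∷ : ∀ f x a y b → ∑ˢ f (x ∷ a) (y ∷ b) ≈ ∑ˢ (x ▷ f) a (y ∷ b) + ∑ˢ (y ▷ f) (x ∷ a) b
  ∑ˢ-∷ f x a y b = trans (∑-++ (map (x ∷_) (shuffles a (y ∷ b))) _ f)
    (reflexive (cong₂ _+_ (∑-map (x ∷_) (shuffles a (y ∷ b)) f) (∑-map (y ∷_) (shuffles (x ∷ a) b) f)))

  ∑ˢ-cong : ∀ a b {f g} → (∀ c → length c ≡ length a ℕ.+ length b → f c ≈ g c) → ∑ˢ f a b ≈ ∑ˢ g a b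
  ∑ˢ-cong a b eq = ∑-congᵃ (All.map (eq _) (shuffles-length a b))

  record IsCharacter (f : Comp → Carrier) : Set where
    field
      unital : f [] ≈ 1#
      mult   : ∀ a b → f a * f b ≈ ∑ˢ f a b

  ∑ᵈ : (Comp → Comp → Carrier) → Comp → Carrier
  ∑ᵈ F r = ∑ (splits r) (λ s → F (proj₁ s) (proj₂ s))

  ∑ᵈ-∷ : ∀ F x r → ∑ᵈ F (x ∷ r) ≡ F [] (x ∷ r) + ∑ᵈ (λ a b → F (x ∷ a) b) r
  ∑ᵈ-∷ F x r = cong (F [] (x ∷ r) +_) (∑-map _ (splits r) _)

  conv : (Comp → Carrier) → (Comp → Carrier) → Comp → Carrier
  conv f g = ∑ᵈ (λ a b → f a * g b)

  conv-∷ : ∀ f g x r → conv f g (x ∷ r) ≡ f [] * g (x ∷ r) + conv (x ▷ f) g r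
  conv-∷ f g = ∑ᵈ-∷ (λ a b → f a * g b)

  -- Deconcatenation is multiplicative for the shuffle product.
  ∑ˢ-conv : ∀ f g a b → ∑ˢ (conv f g) a b ≈ ∑ᵈ (λ a₁ a₂ → ∑ᵈ (λ b₁ b₂ → ∑ˢ f a₁ b₁ * ∑ˢ g a₂ b₂) b) a
  ∑ˢ-conv f g []      b       = begin
    ∑ˢ (conv f g) [] b                                     ≈⟨ ∑ˢ-[]ˡ (conv f g) b ⟩
    conv f g b                                             ≈⟨ ∑-cong (splits b) (λ s → *-cong (∑ˢ-[]ˡ f _) (∑ˢ-[]ˡ g _)) ⟨
    ∑ᵈ (λ b₁ b₂ → ∑ˢ f [] b₁ * ∑ˢ g [] b₂) b               ≈⟨ +-identityʳ _ ⟨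
    ∑ᵈ (λ b₁ b₂ → ∑ˢ f [] b₁ * ∑ˢ g [] b₂) b + 0#          ∎
  ∑ˢ-conv f g (x ∷ a) []      = begin
    ∑ˢ (conv f g) (x ∷ a) []                               ≈⟨ ∑ˢ-[]ʳ (conv f g) (x ∷ a) ⟩
    conv f g (x ∷ a)                                       ≈⟨ ∑-cong (splits (x ∷ a)) (λ s → trans (+-identityʳ _) (*-cong (∑ˢ-[]ʳ f _) (∑ˢ-[]ʳ g _))) ⟨
    ∑ᵈ (λ a₁ a₂ → ∑ᵈ (λ b₁ b₂ → ∑ˢ f a₁ b₁ * ∑ˢ g a₂ b₂) []) (x ∷ a) ∎
  ∑ˢ-conv f g (x ∷ a) (y ∷ b) = begin
    ∑ˢ (conv f g) (x ∷ a) (y ∷ b)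
      ≈⟨ ∑ˢ-∷ (conv f g) x a y b ⟩
    ∑ˢ (x ▷ conv f g) a (y ∷ b) + ∑ˢ (y ▷ conv f g) (x ∷ a) b
      ≈⟨ +-cong (peel x a (y ∷ b)) (peel y (x ∷ a) b) ⟩
    (f [] * ∑ˢ (x ▷ g) a (y ∷ b) + ∑ˢ (conv (x ▷ f) g) a (y ∷ b)) + (f [] * ∑ˢ (y ▷ g) (x ∷ a) b + ∑ˢ (conv (y ▷ f) g) (x ∷ a) b)
      ≈⟨ +-interchange _ _ _ _ ⟩
    (f [] * ∑ˢ (x ▷ g) a (y ∷ b) + f [] * ∑ˢ (y ▷ g) (x ∷ a) b) + (∑ˢ (conv (x ▷ f) g) a (y ∷ b) + ∑ˢ (conv (y ▷ f) g) (x ∷ a) b)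
      ≈⟨ +-cong (trans (sym (distribˡ _ _ _)) (*-congˡ (sym (∑ˢ-∷ g x a y b)))) (+-cong (∑ˢ-conv (x ▷ f) g a (y ∷ b)) (∑ˢ-conv (y ▷ f) g (x ∷ a) b)) ⟩
    f [] * ∑ˢ g (x ∷ a) (y ∷ b) + (∑ᵈ (λ a₁ a₂ → ∑ᵈ (λ b₁ b₂ → ∑ˢ (x ▷ f) a₁ b₁ * ∑ˢ g a₂ b₂) (y ∷ b)) a
                                   + ∑ᵈ (λ a₁ a₂ → ∑ᵈ (λ b₁ b₂ → ∑ˢ (y ▷ f) a₁ b₁ * ∑ˢ g a₂ b₂) b) (x ∷ a))
      ≈⟨ +-congˡ (+-cong left right) ⟩
    f [] * ∑ˢ g (x ∷ a) (y ∷ b) + ((P + Q) + (S + U))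
      ≈⟨ rearrange _ P Q S U ⟩
    (f [] * ∑ˢ g (x ∷ a) (y ∷ b) + S) + (P + (Q + U))
      ≈⟨ +-cong firstRow otherRows ⟨
    ∑ᵈ (λ b₁ b₂ → ∑ˢ f [] b₁ * ∑ˢ g (x ∷ a) b₂) (y ∷ b) + ∑ᵈ (λ a₁ a₂ → ∑ᵈ (λ b₁ b₂ → ∑ˢ f (x ∷ a₁) b₁ * ∑ˢ g a₂ b₂) (y ∷ b)) a
      ≡⟨ ∑ᵈ-∷ (λ a₁ a₂ → ∑ᵈ (λ b₁ b₂ → ∑ˢ f a₁ b₁ * ∑ˢ g a₂ b₂) (y ∷ b)) x a ⟨
    ∑ᵈ (λ a₁ a₂ → ∑ᵈ (λ b₁ b₂ → ∑ˢ f a₁ b₁ * ∑ˢ g a₂ b₂) (y ∷ b)) (x ∷ a)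
      ∎
    where
    -- Pairs of splits are sorted by which first parts are empty: S has only the first part of
    -- `x ∷ a` empty, P only that of `y ∷ b`. When neither is empty, their shuffles begin with x (Q)
    -- or with y (U). The remaining pair, with both empty, is the summand with factor `f []`.
    P Q S U : Carrier
    P = ∑ᵈ (λ a₁ a₂ → f (x ∷ a₁) * ∑ˢ g a₂ (y ∷ b)) a
    Q = ∑ᵈ (λ a₁ a₂ → ∑ᵈ (λ b₁ b₂ → ∑ˢ (x ▷ f) a₁ (y ∷ b₁) * ∑ˢ g a₂ b₂) b) a
    S = ∑ᵈ (λ b₁ b₂ → f (y ∷ b₁) * ∑ˢ g (x ∷ a) b₂) b
    U = ∑ᵈ (λ a₁ a₂ → ∑ᵈ (λ b₁ b₂ → ∑ˢ (y ▷ f) (x ∷ a₁) b₁ * ∑ˢ g a₂ b₂) b) a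
    rearrange : ∀ z p q s u → z + ((p + q) + (s + u)) ≈ (z + s) + (p + (q + u))
    rearrange = solve 5 (λ z p q s u → (z :+ ((p :+ q) :+ (s :+ u))) := ((z :+ s) :+ (p :+ (q :+ u)))) refl
    peel : ∀ z c d → ∑ˢ (z ▷ conv f g) c d ≈ f [] * ∑ˢ (z ▷ g) c d + ∑ˢ (conv (z ▷ f) g) c d
    peel z c d = trans (∑-cong (shuffles c d) (λ r → reflexive (conv-∷ f g z r)))
      (trans (∑-+ (shuffles c d) _ _) (+-congʳ (∑-*ˡ (shuffles c d) (f []) _)))
    left : ∑ᵈ (λ a₁ a₂ → ∑ᵈ (λ b₁ b₂ → ∑ˢ (x ▷ f) a₁ b₁ * ∑ˢ g a₂ b₂) (y ∷ b)) a ≈ P + Q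
    left = trans (∑-cong (splits a) λ s → trans (reflexive (∑ᵈ-∷ _ y b)) (+-congʳ (*-congʳ (∑ˢ-[]ʳ (x ▷ f) (proj₁ s)))))
      (∑-+ (splits a) _ _)
    right : ∑ᵈ (λ a₁ a₂ → ∑ᵈ (λ b₁ b₂ → ∑ˢ (y ▷ f) a₁ b₁ * ∑ˢ g a₂ b₂) b) (x ∷ a) ≈ S + U
    right = trans (reflexive (∑ᵈ-∷ _ x a)) (+-congʳ (∑-cong (splits b) λ s → *-congʳ (∑ˢ-[]ˡ (y ▷ f) (proj₁ s))))
    firstRow : ∑ᵈ (λ b₁ b₂ → ∑ˢ f [] b₁ * ∑ˢ g (x ∷ a) b₂) (y ∷ b) ≈ f [] * ∑ˢ g (x ∷ a) (y ∷ b) + S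
    firstRow = trans (reflexive (∑ᵈ-∷ _ y b))
      (+-cong (*-congʳ (∑ˢ-[]ˡ f [])) (∑-cong (splits b) λ s → *-congʳ (∑ˢ-[]ˡ f (y ∷ proj₁ s))))
    otherRows : ∑ᵈ (λ a₁ a₂ → ∑ᵈ (λ b₁ b₂ → ∑ˢ f (x ∷ a₁) b₁ * ∑ˢ g a₂ b₂) (y ∷ b)) a ≈ P + (Q + U)
    otherRows = trans (∑-cong (splits a) λ s → trans (reflexive (∑ᵈ-∷ _ y b))
        (+-cong (*-congʳ (∑ˢ-[]ʳ f (x ∷ proj₁ s))) (trans (∑-cong (splits b) λ t →
          trans (*-congʳ (∑ˢ-∷ f x (proj₁ s) y (proj₁ t))) (distribʳ _ _ _)) (∑-+ (splits b) _ _))))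
      (trans (∑-+ (splits a) _ _) (+-congˡ (∑-+ (splits a) _ _)))

  conv-mult : ∀ f g a b → conv f g a * conv f g b ≈ ∑ᵈ (λ a₁ a₂ → ∑ᵈ (λ b₁ b₂ → (f a₁ * f b₁) * (g a₂ * g b₂)) b) a
  conv-mult f g a b = trans (∑-*-∑ (splits a) (splits b) _ _)
    (∑-cong (splits a) λ s → ∑-cong (splits b) λ t → *-interchange (f (proj₁ s)) _ _ _)

  conv-character : ∀ {f g} → IsCharacter f → IsCharacter g → IsCharacter (conv f g)
  conv-character {f} {g} f-char g-char = record
    { unital = trans (+-identityʳ _) (trans (*-cong F.unital G.unital) (*-identityˡ 1#))
    ; mult   = λ a b → trans (conv-mult f g a b) (trans
        (∑-cong (splits a) λ s → ∑-cong (splits b) λ t → *-cong (F.mult (proj₁ s) (proj₁ t)) (G.mult (proj₂ s) (proj₂ t)))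
        (sym (∑ˢ-conv f g a b))) }
    where
    module F = IsCharacter f-char
    module G = IsCharacter g-char

  weight : (ℕ → Carrier) → Comp → Carrier
  weight w []      = 1#
  weight w (x ∷ r) = w x * weight w r

  twist : (ℕ → Carrier) → (Comp → Carrier) → Comp → Carrier
  twist w f r = weight w r * f r

  -- The weight is a product over letters, and every shuffle of a and b has the letters of both, so
  -- the weight is a common factor.
  ∑ˢ-twist : ∀ w f a b → ∑ˢ (twist w f) a b ≈ (weight w a * weight w b) * ∑ˢ f a b
  ∑ˢ-twist w f []      b       = trans (+-identityʳ _) (*-cong (sym (*-identityˡ _)) (sym (+-identityʳ _)))
  ∑ˢ-twist w f (x ∷ a) []      = trans (+-identityʳ _) (*-cong (sym (*-identityʳ _)) (sym (+-identityʳ _)))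
  ∑ˢ-twist w f (x ∷ a) (y ∷ b) = begin
    ∑ˢ (twist w f) (x ∷ a) (y ∷ b)
      ≈⟨ ∑ˢ-∷ (twist w f) x a y b ⟩
    ∑ˢ (x ▷ twist w f) a (y ∷ b) + ∑ˢ (y ▷ twist w f) (x ∷ a) b
      ≈⟨ +-cong (peel x a (y ∷ b)) (peel y (x ∷ a) b) ⟩
    w x * ∑ˢ (twist w (x ▷ f)) a (y ∷ b) + w y * ∑ˢ (twist w (y ▷ f)) (x ∷ a) b
      ≈⟨ +-cong (*-congˡ (∑ˢ-twist w (x ▷ f) a (y ∷ b))) (*-congˡ (∑ˢ-twist w (y ▷ f) (x ∷ a) b)) ⟩
    w x * ((A * (w y * B)) * ∑ˢ (x ▷ f) a (y ∷ b)) + w y * (((w x * A) * B) * ∑ˢ (y ▷ f) (x ∷ a) b)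
      ≈⟨ rearrange (w x) (w y) A B _ _ ⟩
    ((w x * A) * (w y * B)) * (∑ˢ (x ▷ f) a (y ∷ b) + ∑ˢ (y ▷ f) (x ∷ a) b)
      ≈⟨ *-congˡ (∑ˢ-∷ f x a y b) ⟨
    ((w x * A) * (w y * B)) * ∑ˢ f (x ∷ a) (y ∷ b)
      ∎
    where
    A = weight w a
    B = weight w b
    rearrange : ∀ u v a b s t → u * ((a * (v * b)) * s) + v * (((u * a) * b) * t) ≈ ((u * a) * (v * b)) * (s + t)
    rearrange = solve 6 (λ u v a b s t → ((u :* ((a :* (v :* b)) :* s)) :+ (v :* (((u :* a) :* b) :* t))) := (((u :* a) :* (v :* b)) :* (s :+ t))) refl
    peel : ∀ z c d → ∑ˢ (z ▷ twist w f) c d ≈ w z * ∑ˢ (twist w (z ▷ f)) c d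
    peel z c d = trans (∑-cong (shuffles c d) λ r → *-assoc _ _ _) (∑-*ˡ (shuffles c d) (w z) _)

  twist-character : ∀ w {f} → IsCharacter f → IsCharacter (twist w f)
  twist-character w {f} f-char = record
    { unital = trans (*-identityˡ _) F.unital
    ; mult   = λ a b → trans (*-interchange _ _ _ _) (trans (*-congˡ (F.mult a b)) (sym (∑ˢ-twist w f a b))) }
    where module F = IsCharacter f-char

  -- Both twists of the construction have this shape: -1 and σ for χ, t and q for τ. On the word of
  -- a chain the two exponents become a difference of sizes and a difference of ranks.
  weight-geometric : ∀ y z r → weight (λ x → y * z ^ x) r ≈ y ^ length r * z ^ sum r
  weight-geometric y z []      = sym (*-identityˡ 1#)
  weight-geometric y z (x ∷ r) = begin
    (y * z ^ x) * weight (λ x → y * z ^ x) r       ≈⟨ *-congˡ (weight-geometric y z r) ⟩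
    (y * z ^ x) * (y ^ length r * z ^ sum r)       ≈⟨ *-interchange _ _ _ _ ⟩
    (y * y ^ length r) * (z ^ x * z ^ sum r)       ≈⟨ *-congˡ (^-homo-* z x (sum r)) ⟨
    y ^ suc (length r) * z ^ (x ℕ.+ sum r)         ∎

  -- The abstract argument asks for rational coefficients only through this invertibility of
  -- factorials.
  IsInverseFactorial : (ℕ → Carrier) → Set
  IsInverseFactorial ι = ∀ k → (k !) × ι k ≈ 1#

  module _ {ι : ℕ → Carrier} (ι-inverse : IsInverseFactorial ι) where

    ι-0 : ι 0 ≈ 1#
    ι-0 = trans (sym (+-identityʳ _)) (ι-inverse 0)

    -- 1/(i! j!) is 1/(i + j)! times a binomial coefficient, and that coefficient counts the
    -- shuffles, all of length i + j.
    inverseFactorial-character : IsCharacter (ι ∘ length)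
    inverseFactorial-character = record { unital = ι-0 ; mult = ι-mult }
      where
      ι-mult : ∀ a b → ι (length a) * ι (length b) ≈ ∑ˢ (ι ∘ length) a b
      ι-mult a b = begin
        ι A * ι B                                        ≈⟨ *-identityʳ _ ⟨
        (ι A * ι B) * 1#                                 ≈⟨ *-congˡ (ι-inverse (A ℕ.+ B)) ⟨
        (ι A * ι B) * (((A ℕ.+ B) !) × ι (A ℕ.+ B))      ≈⟨ *-congˡ (×-congˡ (length-shuffles a b)) ⟨
        (ι A * ι B) * ((N ℕ.* (A ! ℕ.* B !)) × C)        ≈⟨ *-congˡ (×-congˡ (ℕ.*-comm N _)) ⟩
        (ι A * ι B) * (((A ! ℕ.* B !) ℕ.* N) × C)        ≈⟨ *-congˡ (×-assocˡ C (A ! ℕ.* B !) N) ⟨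
        (ι A * ι B) * ((A ! ℕ.* B !) × (N × C))          ≈⟨ *-congˡ (×-assocˡ (N × C) (A !) (B !)) ⟨
        (ι A * ι B) * ((A !) × ((B !) × (N × C)))        ≈⟨ ×-comm-* (A !) _ _ ⟩
        (A !) × ((ι A * ι B) * ((B !) × (N × C)))        ≈⟨ ×-congʳ (A !) (*-assoc _ _ _) ⟩
        (A !) × (ι A * (ι B * ((B !) × (N × C))))        ≈⟨ ×-assoc-* (A !) _ _ ⟨
        ((A !) × ι A) * (ι B * ((B !) × (N × C)))        ≈⟨ *-cong (ι-inverse A) (×-comm-* (B !) _ _) ⟩
        1# * ((B !) × (ι B * (N × C)))                   ≈⟨ *-congˡ (×-assoc-* (B !) _ _) ⟨
        1# * (((B !) × ι B) * (N × C))                   ≈⟨ *-identityˡ _ ⟩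
        ((B !) × ι B) * (N × C)                          ≈⟨ *-congʳ (ι-inverse B) ⟩
        1# * (N × C)                                     ≈⟨ *-identityˡ _ ⟩
        N × C                                            ≈⟨ ∑-const (shuffles a b) C ⟨
        ∑ (shuffles a b) (λ _ → C)                       ≈⟨ ∑ˢ-cong a b (λ c eq → reflexive (cong ι (≡.sym eq))) ⟩
        ∑ˢ (ι ∘ length) a b                              ∎
        where
        A = length a
        B = length b
        C = ι (A ℕ.+ B)
        N = length (shuffles a b)

-- tr n is the projection onto the components of degree less than n.
record IsTruncation (R : CommutativeRing 0ℓ 0ℓ) (tr : ℕ → CommutativeRing.Carrier R → CommutativeRing.Carrier R) : Set where
  open CommutativeRing R
  field
    tr-cong     : ∀ n {x y} → x ≈ y → tr n x ≈ tr n y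
    tr-+        : ∀ n x y → tr n (x + y) ≈ tr n x + tr n y
    tr-idem     : ∀ n x → tr n (tr n x) ≈ tr n x
    tr-zero     : ∀ x → tr 0 x ≈ 0#
    tr-low-mono : ∀ {m n} x → m ≤ n → tr m x ≈ x → tr n x ≈ x
    tr-low-*    : ∀ m n x y → tr (suc m) x ≈ x → tr (suc n) y ≈ y → tr (suc (m ℕ.+ n)) (x * y) ≈ x * y
    tr-high-*   : ∀ m n x y → tr m x ≈ 0# → tr n y ≈ 0# → tr (m ℕ.+ n) (x * y) ≈ 0#

-- Birkhoff factorisation with respect to a truncation

module Birkhoff
  (R : CommutativeRing 0ℓ 0ℓ)
  (tr : ℕ → CommutativeRing.Carrier R → CommutativeRing.Carrier R)
  (tr-isTruncation : IsTruncation R tr)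
  where

  open Sums R
  open Characters R
  open IsTruncation tr-isTruncation

  tr-additive : ∀ n → Additive (tr n)
  tr-additive n = record { Φ-cong = tr-cong n ; Φ-+ = tr-+ n }

  module Tr n = Additive (tr-additive n)

  neg-additive : Additive -_
  neg-additive = record { Φ-cong = -‿cong ; Φ-+ = λ x y → sym (-‿+-comm x y) }

  -- Elements without components below degree n form an ideal: this is `tr-high-*` with bounds n and
  -- 0, the second of which holds for every z.
  tr-*-congʳ : ∀ n {x y} z → tr n x ≈ tr n y → tr n (x * z) ≈ tr n (y * z)
  tr-*-congʳ n {x} {y} z eq = begin
    tr n (x * z)                          ≈⟨ tr-cong n (*-congʳ x≈) ⟩
    tr n (((x + - y) + y) * z)            ≈⟨ tr-cong n (distribʳ z _ y) ⟩
    tr n ((x + - y) * z + y * z)          ≈⟨ tr-+ n _ _ ⟩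
    tr n ((x + - y) * z) + tr n (y * z)   ≈⟨ +-congʳ high ⟩
    0# + tr n (y * z)                     ≈⟨ +-identityˡ _ ⟩
    tr n (y * z)                          ∎
    where
    x≈ : x ≈ (x + - y) + y
    x≈ = sym (trans (+-assoc x _ y) (trans (+-congˡ (-‿inverseˡ y)) (+-identityʳ x)))
    tr-diff : tr n (x + - y) ≈ 0#
    tr-diff = trans (tr-+ n x _) (trans (+-cong eq (Tr.Φ-neg n y)) (-‿inverseʳ _))
    high : tr n ((x + - y) * z) ≈ 0#
    high = subst (λ k → tr k ((x + - y) * z) ≈ 0#) (ℕ.+-identityʳ n) (tr-high-* n 0 _ z tr-diff (tr-zero z))

  tr-*-cong : ∀ n {x x' y y'} → tr n x ≈ tr n x' → tr n y ≈ tr n y' → tr n (x * y) ≈ tr n (x' * y')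
  tr-*-cong n {x} {x'} {y} {y'} eq eq' = begin
    tr n (x * y)     ≈⟨ tr-*-congʳ n y eq ⟩
    tr n (x' * y)    ≈⟨ tr-cong n (*-comm x' y) ⟩
    tr n (y * x')    ≈⟨ tr-*-congʳ n x' eq' ⟩
    tr n (y' * x')   ≈⟨ tr-cong n (*-comm y' x') ⟩
    tr n (x' * y')   ∎

  tr-^-cong : ∀ n {x y} → tr n x ≈ tr n y → ∀ k → tr n (x ^ k) ≈ tr n (y ^ k)
  tr-^-cong n eq zero    = refl
  tr-^-cong n eq (suc k) = tr-*-cong n eq (tr-^-cong n eq k)

  tr-weight-cong : ∀ n {w w'} → (∀ x → tr n (w x) ≈ tr n (w' x)) → ∀ r → tr n (weight w r) ≈ tr n (weight w' r)
  tr-weight-cong n eq []      = refl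
  tr-weight-cong n eq (x ∷ r) = tr-*-cong n (eq x) (tr-weight-cong n eq r)

  tr-conv-cong : ∀ n f {g h} → (∀ r → tr n (g r) ≈ tr n (h r)) → ∀ r → tr n (conv f g r) ≈ tr n (conv f h r)
  tr-conv-cong n f {g} {h} eq r = begin
    tr n (conv f g r)                                        ≈⟨ Tr.Φ-∑ n (splits r) _ ⟩
    ∑ (splits r) (λ s → tr n (f (proj₁ s) * g (proj₂ s)))    ≈⟨ ∑-cong (splits r) (λ s → tr-*-cong n refl (eq (proj₂ s))) ⟩
    ∑ (splits r) (λ s → tr n (f (proj₁ s) * h (proj₂ s)))    ≈⟨ Tr.Φ-∑ n (splits r) _ ⟨
    tr n (conv f h r)                                        ∎

  -- Convolving with `removeUnit g` omits the split whose second part is empty. On chains this turns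
  -- the sum over all subsets of A into the sum over proper ones.
  removeUnit : (Comp → Carrier) → Comp → Carrier
  removeUnit g []      = 0#
  removeUnit g (x ∷ r) = g (x ∷ r)

  conv-removeUnit : ∀ f g r → conv f g r ≈ conv f (removeUnit g) r + f r * g []
  conv-removeUnit f g []      = begin
    f [] * g [] + 0#                        ≈⟨ +-comm _ _ ⟩
    0# + f [] * g []                        ≈⟨ +-congʳ (trans (+-identityʳ _) (zeroʳ _)) ⟨
    (f [] * 0# + 0#) + f [] * g []          ∎
  conv-removeUnit f g (x ∷ r) = begin
    conv f g (x ∷ r)
      ≡⟨ conv-∷ f g x r ⟩
    f [] * g (x ∷ r) + conv (x ▷ f) g r
      ≈⟨ +-congˡ (conv-removeUnit (x ▷ f) g r) ⟩
    f [] * g (x ∷ r) + (conv (x ▷ f) (removeUnit g) r + f (x ∷ r) * g [])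
      ≈⟨ +-assoc _ _ _ ⟨
    (f [] * g (x ∷ r) + conv (x ▷ f) (removeUnit g) r) + f (x ∷ r) * g []
      ≡⟨ cong (_+ f (x ∷ r) * g []) (conv-∷ f (removeUnit g) x r) ⟨
    conv f (removeUnit g) (x ∷ r) + f (x ∷ r) * g []
      ∎

  -- The whole word r occurs only with the factor 0, so strictly shorter prefixes determine the
  -- value. This is what makes the recursion for π well founded.
  conv-removeUnit-cong : ∀ {f f'} g r → (∀ a → length a < length r → f a ≈ f' a) →
                         conv f (removeUnit g) r ≈ conv f' (removeUnit g) r
  conv-removeUnit-cong {f} {f'} g []      eq = +-congʳ (trans (zeroʳ _) (sym (zeroʳ _)))
  conv-removeUnit-cong {f} {f'} g (x ∷ r) eq = begin
    conv f (removeUnit g) (x ∷ r)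
      ≡⟨ conv-∷ f (removeUnit g) x r ⟩
    f [] * g (x ∷ r) + conv (x ▷ f) (removeUnit g) r
      ≈⟨ +-cong (*-congʳ (eq [] (s≤s z≤n))) (conv-removeUnit-cong g r (λ a lt → eq (x ∷ a) (s≤s lt))) ⟩
    f' [] * g (x ∷ r) + conv (x ▷ f') (removeUnit g) r
      ≡⟨ conv-∷ f' (removeUnit g) x r ⟨
    conv f' (removeUnit g) (x ∷ r)
      ∎

  ∑ᵈ-last : ∀ F r → (∀ a b → length a < length r → F a b ≈ 0#) → ∑ᵈ F r ≈ F r []
  ∑ᵈ-last F []      eq = +-identityʳ _
  ∑ᵈ-last F (x ∷ r) eq = begin
    ∑ᵈ F (x ∷ r)                                      ≡⟨ ∑ᵈ-∷ F x r ⟩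
    F [] (x ∷ r) + ∑ᵈ (λ a b → F (x ∷ a) b) r         ≈⟨ +-cong (eq [] _ (s≤s z≤n)) (∑ᵈ-last _ r (λ a b lt → eq (x ∷ a) b (s≤s lt))) ⟩
    0# + F (x ∷ r) []                                 ≈⟨ +-identityˡ _ ⟩
    F (x ∷ r) []                                      ∎

  ∑ᵈ-zero : ∀ F r → (∀ a b → length a ≤ length r → F a b ≈ 0#) → ∑ᵈ F r ≈ 0#
  ∑ᵈ-zero F r eq = trans (∑ᵈ-last F r (λ a b lt → eq a b (ℕ.<⇒≤ lt))) (eq r [] ℕ.≤-refl)

  -- The Birkhoff factorisation π ⋆ χ of a family of characters χ N that
  -- agree up to degree d for N ≥ d: π r has degree less than the length of
  -- r (for r nonempty), and conv π (χ N) r has no component of such degree.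
  module Factorisation
    (χ : ℕ → Comp → Carrier)
    (χ-character : ∀ N → IsCharacter (χ N))
    (χ-stable : ∀ d k r → tr (suc d) (χ (k ℕ.+ d) r) ≈ tr (suc d) (χ d r))
    where

    -- The fuel runs parallel to that of `Pfun`, so that the two can be compared stage by stage; the
    -- value is the intended one once the fuel reaches the length of the word. A word of length d +
    -- 1 calls `χ d`, just as a set of size d + 1 calls `σ≤ d`.
    πᶠ : ℕ → Comp → Carrier
    πᶠ zero    r       = 1#
    πᶠ (suc k) []      = 1#
    πᶠ (suc k) (x ∷ r) = - tr (suc (length r)) (conv (πᶠ k) (removeUnit (χ (length r))) (x ∷ r))

    π : Comp → Carrier
    π r = πᶠ (length r) r

    πᶠ-stable : ∀ j k r → length r ≤ j → length r ≤ k → πᶠ j r ≈ πᶠ k r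
    πᶠ-stable zero    zero    r       _  _  = refl
    πᶠ-stable zero    (suc k) []      _  _  = refl
    πᶠ-stable (suc j) zero    []      _  _  = refl
    πᶠ-stable (suc j) (suc k) []      _  _  = refl
    πᶠ-stable (suc j) (suc k) (x ∷ r) (s≤s ≤j) (s≤s ≤k) = -‿cong (tr-cong _
      (conv-removeUnit-cong _ (x ∷ r) λ a lt →
        πᶠ-stable j k a (ℕ.≤-trans (s≤s⁻¹ lt) ≤j) (ℕ.≤-trans (s≤s⁻¹ lt) ≤k)))

    π-∷ : ∀ x r → π (x ∷ r) ≈ - tr (suc (length r)) (conv π (removeUnit (χ (length r))) (x ∷ r))
    π-∷ x r = -‿cong (tr-cong _ (conv-removeUnit-cong _ (x ∷ r) λ a lt →
      πᶠ-stable (length r) (length a) a (s≤s⁻¹ lt) ℕ.≤-refl))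

    π-low : ∀ x r → tr (suc (length r)) (π (x ∷ r)) ≈ π (x ∷ r)
    π-low x r = trans (Tr.Φ-neg _ _) (-‿cong (tr-idem _ _))

    -- The trivial split contributes π r, chosen to cancel the low part of all other splits. That
    -- choice was made with a smaller index of χ; stability allows every N from the length of r on,
    -- so that words of different lengths can share one N.
    conv-high : ∀ N r → length r ≤ N → tr (length r) (conv π (χ N) r) ≈ 0#
    conv-high N []      _    = tr-zero _
    conv-high N (x ∷ r) r<N = begin
      tr n (conv π (χ N) (x ∷ r))
        ≈⟨ tr-cong n (conv-removeUnit π (χ N) (x ∷ r)) ⟩
      tr n (conv π (removeUnit (χ N)) (x ∷ r) + π (x ∷ r) * χ N [])
        ≈⟨ tr-+ n _ _ ⟩
      tr n (conv π (removeUnit (χ N)) (x ∷ r)) + tr n (π (x ∷ r) * χ N [])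
        ≈⟨ +-cong (tr-conv-cong n π stable (x ∷ r)) (tr-cong n (trans (*-congˡ (IsCharacter.unital (χ-character N))) (*-identityʳ _))) ⟩
      tr n (conv π (removeUnit (χ (length r))) (x ∷ r)) + tr n (π (x ∷ r))
        ≈⟨ +-congˡ (trans (π-low x r) (π-∷ x r)) ⟩
      tr n (conv π (removeUnit (χ (length r))) (x ∷ r)) + - tr n (conv π (removeUnit (χ (length r))) (x ∷ r))
        ≈⟨ -‿inverseʳ _ ⟩
      0#
        ∎
      where
      n = suc (length r)
      N≡ : (N ℕ.∸ length r) ℕ.+ length r ≡ N
      N≡ = ℕ.m∸n+n≡m (ℕ.<⇒≤ r<N)
      stable : ∀ a → tr n (removeUnit (χ N) a) ≈ tr n (removeUnit (χ (length r)) a)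
      stable []      = refl
      stable (y ∷ a) = subst (λ M → tr n (χ M (y ∷ a)) ≈ tr n (χ (length r) (y ∷ a))) N≡
        (χ-stable (length r) (N ℕ.∸ length r) (y ∷ a))

    defect : Comp → Comp → Carrier
    defect a b = π a * π b + - ∑ˢ π a b

    -- The product has degree at most (ℓ - 1) + (ℓ' - 1) for words of lengths ℓ and ℓ', and each
    -- shuffle has length ℓ + ℓ', so π of it has smaller degree than that. Nonemptiness matters,
    -- because π of the empty word is 1, which is not of degree below 0.
    defect-low : ∀ x a y b → let n = length (x ∷ a) ℕ.+ length (y ∷ b) in
                 tr n (defect (x ∷ a) (y ∷ b)) ≈ defect (x ∷ a) (y ∷ b)
    defect-low x a y b = trans (tr-+ n _ _) (+-cong product-low (trans (Tr.Φ-neg n _) (-‿cong shuffle-low)))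
      where
      n = length (x ∷ a) ℕ.+ length (y ∷ b)
      product-low : tr n (π (x ∷ a) * π (y ∷ b)) ≈ π (x ∷ a) * π (y ∷ b)
      product-low = tr-low-mono _ (s≤s (ℕ.+-monoʳ-≤ (length a) (ℕ.n≤1+n _)))
        (tr-low-* (length a) (length b) _ _ (π-low x a) (π-low y b))
      low : ∀ c → length c ≡ n → tr n (π c) ≈ π c
      low (z ∷ c) eq = subst (λ k → tr k (π (z ∷ c)) ≈ π (z ∷ c)) eq (π-low z c)
      shuffle-low : tr n (∑ˢ π (x ∷ a) (y ∷ b)) ≈ ∑ˢ π (x ∷ a) (y ∷ b)
      shuffle-low = trans (Tr.Φ-∑ n (shuffles (x ∷ a) (y ∷ b)) π) (∑ˢ-cong (x ∷ a) (y ∷ b) low)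

    -- All splits but the trivial one cancel by induction, so the defect has
    -- no component of degree below length a + length b.
    defect-high : ∀ a b → (∀ a' b' → length a' ℕ.+ length b' < length a ℕ.+ length b → defect a' b' ≈ 0#) →
                  tr (length a ℕ.+ length b) (defect a b) ≈ 0#
    defect-high a b smaller = begin
      tr n (defect a b)
        ≈⟨ tr-cong n (*-identityʳ _) ⟨
      tr n (defect a b * 1#)
        ≈⟨ tr-cong n (*-congˡ (trans (+-identityʳ _) X.unital)) ⟨
      tr n (defect a b * ∑ˢ χN [] [])
        ≈⟨ tr-cong n lastSplit ⟨
      tr n (∑ᵈ (λ a₁ a₂ → ∑ᵈ (λ b₁ b₂ → defect a₁ b₁ * ∑ˢ χN a₂ b₂) b) a)
        ≈⟨ tr-cong n expand ⟩
      tr n (conv π χN a * conv π χN b + - ∑ˢ (conv π χN) a b)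
        ≈⟨ tr-+ n _ _ ⟩
      tr n (conv π χN a * conv π χN b) + tr n (- ∑ˢ (conv π χN) a b)
        ≈⟨ +-cong (tr-high-* (length a) (length b) _ _ (conv-high n a (ℕ.m≤m+n _ _)) (conv-high n b (ℕ.m≤n+m _ (length a)))) (trans (Tr.Φ-neg n _) (-‿cong shuffle-high)) ⟩
      0# + - 0#
        ≈⟨ -‿inverseʳ 0# ⟩
      0#
        ∎
      where
      n = length a ℕ.+ length b
      -- One character serves throughout: n bounds the lengths of a and b and equals the length of
      -- each of their shuffles.
      χN = χ n
      module X = IsCharacter (χ-character n)
      shuffle-high : tr n (∑ˢ (conv π χN) a b) ≈ 0#
      shuffle-high = trans (Tr.Φ-∑ n (shuffles a b) _) (trans
        (∑ˢ-cong a b λ c eq → subst (λ k → tr k (conv π χN c) ≈ 0#) eq (conv-high n c (ℕ.≤-reflexive eq)))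
        (∑-0 (shuffles a b)))
      lastSplit : ∑ᵈ (λ a₁ a₂ → ∑ᵈ (λ b₁ b₂ → defect a₁ b₁ * ∑ˢ χN a₂ b₂) b) a ≈ defect a b * ∑ˢ χN [] []
      lastSplit = trans
        (∑ᵈ-last _ a λ a₁ a₂ lt → ∑ᵈ-zero _ b λ b₁ b₂ le →
          trans (*-congʳ (smaller a₁ b₁ (ℕ.+-mono-<-≤ lt le))) (zeroˡ _))
        (∑ᵈ-last _ b λ b₁ b₂ lt → trans (*-congʳ (smaller a b₁ (ℕ.+-monoʳ-< (length a) lt))) (zeroˡ _))
      expand : ∑ᵈ (λ a₁ a₂ → ∑ᵈ (λ b₁ b₂ → defect a₁ b₁ * ∑ˢ χN a₂ b₂) b) a
             ≈ conv π χN a * conv π χN b + - ∑ˢ (conv π χN) a b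
      expand = begin
        ∑ᵈ (λ a₁ a₂ → ∑ᵈ (λ b₁ b₂ → defect a₁ b₁ * ∑ˢ χN a₂ b₂) b) a
          ≈⟨ (∑-cong (splits a) λ s → ∑-cong (splits b) λ t → trans (distribʳ _ _ _)
                (+-cong (*-congˡ (sym (X.mult (proj₂ s) (proj₂ t)))) (sym (-‿distribˡ-* _ _)))) ⟩
        ∑ᵈ (λ a₁ a₂ → ∑ᵈ (λ b₁ b₂ → (π a₁ * π b₁) * (χN a₂ * χN b₂) + - (∑ˢ π a₁ b₁ * ∑ˢ χN a₂ b₂)) b) a
          ≈⟨ (∑-cong (splits a) λ s → trans (∑-+ (splits b) _ _) (+-congˡ (sym (Neg.Φ-∑ (splits b) _)))) ⟩
        ∑ᵈ (λ a₁ a₂ → ∑ᵈ (λ b₁ b₂ → (π a₁ * π b₁) * (χN a₂ * χN b₂)) b + - ∑ᵈ (λ b₁ b₂ → ∑ˢ π a₁ b₁ * ∑ˢ χN a₂ b₂) b) a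
          ≈⟨ trans (∑-+ (splits a) _ _) (+-congˡ (sym (Neg.Φ-∑ (splits a) _))) ⟩
        ∑ᵈ (λ a₁ a₂ → ∑ᵈ (λ b₁ b₂ → (π a₁ * π b₁) * (χN a₂ * χN b₂)) b) a
          + - ∑ᵈ (λ a₁ a₂ → ∑ᵈ (λ b₁ b₂ → ∑ˢ π a₁ b₁ * ∑ˢ χN a₂ b₂) b) a
          ≈⟨ +-cong (conv-mult π χN a b) (-‿cong (∑ˢ-conv π χN a b)) ⟨
        conv π χN a * conv π χN b + - ∑ˢ (conv π χN) a b
          ∎
        where module Neg = Additive neg-additive

    -- Strong induction on the total length. For nonempty words the truncation at that length both
    -- fixes and kills the defect; if a word is empty, its π is 1 and there is a single shuffle.
    defect≈0 : ∀ k a b → length a ℕ.+ length b < k → defect a b ≈ 0#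
    defect≈0 (suc k) []      b       lt = trans
      (+-cong (*-identityˡ _) (-‿cong (∑ˢ-[]ˡ π b))) (-‿inverseʳ _)
    defect≈0 (suc k) (x ∷ a) []      lt = trans
      (+-cong (*-identityʳ _) (-‿cong (∑ˢ-[]ʳ π (x ∷ a)))) (-‿inverseʳ _)
    defect≈0 (suc k) (x ∷ a) (y ∷ b) lt = trans (sym (defect-low x a y b))
      (defect-high (x ∷ a) (y ∷ b) λ a' b' lt' → defect≈0 k a' b' (ℕ.<-≤-trans lt' (s≤s⁻¹ lt)))

    π-character : IsCharacter π
    π-character = record { unital = refl ; mult = π-mult }
      where
      π-mult : ∀ a b → π a * π b ≈ ∑ˢ π a b
      π-mult a b = begin
        π a * π b                                  ≈⟨ +-identityʳ _ ⟨
        π a * π b + 0#                             ≈⟨ +-congˡ (-‿inverseˡ _) ⟨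
        π a * π b + (- ∑ˢ π a b + ∑ˢ π a b)        ≈⟨ +-assoc _ _ _ ⟨
        defect a b + ∑ˢ π a b                      ≈⟨ +-congʳ (defect≈0 _ a b ℕ.≤-refl) ⟩
        0# + ∑ˢ π a b                              ≈⟨ +-identityˡ _ ⟩
        ∑ˢ π a b                                   ∎

-- Subsets of a finite set

_∪｛_｝ : ∀ {n} → Subset n → Fin n → Subset n
A ∪｛ i ｝ = A [ i ]≔ inside

eqᵇ⇒≡ : ∀ {n} (A B : Subset n) → eqᵇ A B ≡ true → A ≡ B
eqᵇ⇒≡ []           []           _  = ≡.refl
eqᵇ⇒≡ (true  ∷ A) (true  ∷ B) eq = cong (true ∷_) (eqᵇ⇒≡ A B eq)
eqᵇ⇒≡ (false ∷ A) (false ∷ B) eq = cong (false ∷_) (eqᵇ⇒≡ A B eq)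

eqᵇ-refl : ∀ {n} (A : Subset n) → eqᵇ A A ≡ true
eqᵇ-refl []          = ≡.refl
eqᵇ-refl (true  ∷ A) = eqᵇ-refl A
eqᵇ-refl (false ∷ A) = eqᵇ-refl A

∣∪｛｝∣ : ∀ {n} (A : Subset n) i → lookup A i ≡ false → ∣ A ∪｛ i ｝ ∣ ≡ suc ∣ A ∣
∣∪｛｝∣ (false ∷ A) zero    _  = ≡.refl
∣∪｛｝∣ (true  ∷ A) (suc i) eq = cong suc (∣∪｛｝∣ A i eq)
∣∪｛｝∣ (false ∷ A) (suc i) eq = ∣∪｛｝∣ A i eq

⊆-∪｛｝ : ∀ {n} (A : Subset n) i → A ⊆ A ∪｛ i ｝
⊆-∪｛｝ (_ ∷ A) zero    here      = here
⊆-∪｛｝ (_ ∷ A) zero    (there p) = there p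
⊆-∪｛｝ (_ ∷ A) (suc i) here      = here
⊆-∪｛｝ (_ ∷ A) (suc i) (there p) = there (⊆-∪｛｝ A i p)

n≤∣A∣⇒∈ : ∀ {n} (A : Subset n) i → n ≤ ∣ A ∣ → lookup A i ≡ true
n≤∣A∣⇒∈ {n} A i n≤ with lookup A i in eq
... | true  = ≡.refl
... | false = contradiction (∣p∣≤n (A ∪｛ i ｝)) (ℕ.<⇒≱ (subst (n <_) (≡.sym (∣∪｛｝∣ A i eq)) (s≤s n≤)))

⊆ᵇ⇒∣∣≤ : ∀ {n} (A B : Subset n) → ⊆ᵇ A B ≡ true → ∣ A ∣ ≤ ∣ B ∣
⊆ᵇ⇒∣∣≤ []           []          _  = z≤n
⊆ᵇ⇒∣∣≤ (true  ∷ A) (true  ∷ B) eq = s≤s (⊆ᵇ⇒∣∣≤ A B eq)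
⊆ᵇ⇒∣∣≤ (false ∷ A) (true  ∷ B) eq = ℕ.m≤n⇒m≤1+n (⊆ᵇ⇒∣∣≤ A B eq)
⊆ᵇ⇒∣∣≤ (false ∷ A) (false ∷ B) eq = ⊆ᵇ⇒∣∣≤ A B eq

⊂ᵇ⇒∣∣< : ∀ {n} (A B : Subset n) → ⊆ᵇ A B ≡ true → eqᵇ A B ≡ false → ∣ A ∣ < ∣ B ∣
⊂ᵇ⇒∣∣< []          []          sub ()
⊂ᵇ⇒∣∣< (true  ∷ A) (true  ∷ B) sub neq = s≤s (⊂ᵇ⇒∣∣< A B sub neq)
⊂ᵇ⇒∣∣< (false ∷ A) (true  ∷ B) sub neq = s≤s (⊆ᵇ⇒∣∣≤ A B sub)
⊂ᵇ⇒∣∣< (false ∷ A) (false ∷ B) sub neq = ⊂ᵇ⇒∣∣< A B sub neq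

⊆ᵇ-refl : ∀ {n} (A : Subset n) → ⊆ᵇ A A ≡ true
⊆ᵇ-refl []          = ≡.refl
⊆ᵇ-refl (true  ∷ A) = ⊆ᵇ-refl A
⊆ᵇ-refl (false ∷ A) = ⊆ᵇ-refl A

⊥-⊆ᵇ : ∀ {n} (A : Subset n) → ⊆ᵇ ⊥ A ≡ true
⊥-⊆ᵇ []      = ≡.refl
⊥-⊆ᵇ (_ ∷ A) = ⊥-⊆ᵇ A

⊆ᵇ-⊤ : ∀ {n} (A : Subset n) → ⊆ᵇ A ⊤ ≡ true
⊆ᵇ-⊤ []          = ≡.refl
⊆ᵇ-⊤ (true  ∷ A) = ⊆ᵇ-⊤ A
⊆ᵇ-⊤ (false ∷ A) = ⊆ᵇ-⊤ A

⊈ᵇ-∪｛｝ : ∀ {n} (A B : Subset n) i → ⊆ᵇ A B ≡ false → ⊆ᵇ (A ∪｛ i ｝) B ≡ false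
⊈ᵇ-∪｛｝ (true  ∷ A) (true  ∷ B) zero    eq = eq
⊈ᵇ-∪｛｝ (true  ∷ A) (false ∷ B) zero    eq = ≡.refl
⊈ᵇ-∪｛｝ (false ∷ A) (true  ∷ B) zero    eq = eq
⊈ᵇ-∪｛｝ (false ∷ A) (false ∷ B) zero    eq = ≡.refl
⊈ᵇ-∪｛｝ (true  ∷ A) (true  ∷ B) (suc i) eq = ⊈ᵇ-∪｛｝ A B i eq
⊈ᵇ-∪｛｝ (true  ∷ A) (false ∷ B) (suc i) eq = ≡.refl
⊈ᵇ-∪｛｝ (false ∷ A) (_     ∷ B) (suc i) eq = ⊈ᵇ-∪｛｝ A B i eq

-- Sums over subsets and over covers

module SubsetSums (R : CommutativeRing 0ℓ 0ℓ) where
  open Sums R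

  ∑-filter : ∀ {A} (b : A → Bool) (xs : List A) (f : A → Carrier) →
             ∑ (filter (λ x → T? (b x)) xs) f ≈ ∑ xs (λ x → if b x then f x else 0#)
  ∑-filter b []       f = refl
  ∑-filter b (x ∷ xs) f with b x
  ... | true  = +-congˡ (∑-filter b xs f)
  ... | false = trans (∑-filter b xs f) (sym (+-identityˡ _))

  ∑-allSubsets-suc : ∀ {n} (f : Subset (suc n) → Carrier) →
    ∑ (allSubsets (suc n)) f ≈ ∑ (allSubsets n) (f ∘ (true ∷_)) + ∑ (allSubsets n) (f ∘ (false ∷_))
  ∑-allSubsets-suc {n} f = trans (∑-++ (map (true ∷_) (allSubsets n)) _ f)
    (reflexive (cong₂ _+_ (∑-map (true ∷_) (allSubsets n) f) (∑-map (false ∷_) (allSubsets n) f)))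

  ∑-single : ∀ {n} (A : Subset n) (f : Subset n → Carrier) →
             ∑ (allSubsets n) (λ C → if eqᵇ A C then f C else 0#) ≈ f A
  ∑-single []          f = +-identityʳ _
  ∑-single {suc n} (true  ∷ A) f = trans (∑-allSubsets-suc (λ C → if eqᵇ (true ∷ A) C then f C else 0#))
    (trans (+-cong (∑-single A (f ∘ (true ∷_))) (∑-0 (allSubsets n))) (+-identityʳ _))
  ∑-single {suc n} (false ∷ A) f = trans (∑-allSubsets-suc (λ C → if eqᵇ (false ∷ A) C then f C else 0#))
    (trans (+-cong (∑-0 (allSubsets n)) (∑-single A (f ∘ (false ∷_)))) (+-identityˡ _))

  ∑-allFin-suc : ∀ n (f : Fin (suc n) → Carrier) → ∑ (allFin (suc n)) f ≡ f zero + ∑ (allFin n) (f ∘ suc)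
  ∑-allFin-suc n f = cong (f zero +_) (≡.trans (cong (λ xs → ∑ xs f) (≡.sym (map-tabulate (λ i → i) suc))) (∑-map suc (allFin n) f))

  -- The covers of A inside B are the A ∪ {i} with i ∈ B ∖ A.
  ∑-covers : ∀ {n} (A B : Subset n) → ⊆ᵇ A B ≡ true → ∀ c →
    ∑ (allFin n) (λ i → if lookup A i then 0# else (if ⊆ᵇ (A ∪｛ i ｝) B then c else 0#)) ≈ (∣ B ∣ ∸ ∣ A ∣) × c
  ∑-covers []          []          _   c = refl
  ∑-covers {suc n} (true  ∷ A) (true  ∷ B) sub c =
    trans (reflexive (∑-allFin-suc n _)) (trans (+-identityˡ _) (∑-covers A B sub c))
  ∑-covers {suc n} (false ∷ A) (true  ∷ B) sub c = begin
    ∑ (allFin (suc n)) _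
      ≡⟨ ∑-allFin-suc n _ ⟩
    (if ⊆ᵇ A B then c else 0#) + ∑ (allFin n) _
      ≈⟨ +-cong (reflexive (cong (if_then c else 0#) sub)) (∑-covers A B sub c) ⟩
    suc (∣ B ∣ ∸ ∣ A ∣) × c
      ≡⟨ cong (_× c) (ℕ.+-∸-assoc 1 (⊆ᵇ⇒∣∣≤ A B sub)) ⟨
    (suc ∣ B ∣ ∸ ∣ A ∣) × c
      ∎
  ∑-covers {suc n} (false ∷ A) (false ∷ B) sub c =
    trans (reflexive (∑-allFin-suc n _)) (trans (+-identityˡ _) (∑-covers A B sub c))

-- Sums over saturated chains

module Chains (R : CommutativeRing 0ℓ 0ℓ) {n : ℕ} (rk : Subset n → ℕ)
              (rk-mono : ∀ A B → A ⊆ B → rk A ≤ rk B) where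
  open Sums R
  open Characters R
  open SubsetSums R

  increment : Subset n → Fin n → ℕ
  increment A i = rk (A ∪｛ i ｝) ∸ rk A

  -- The sum of f (r c) over the saturated chains c of length at most m from A to B.
  ∑ᶜ : ℕ → (Comp → Carrier) → Subset n → Subset n → Carrier
  ∑ᶜ zero    f A B = if eqᵇ A B then f [] else 0#
  ∑ᶜ (suc m) f A B = (if eqᵇ A B then f [] else 0#) +
    ∑ (allFin n) (λ i → if lookup A i then 0# else ∑ᶜ m (increment A i ▷ f) (A ∪｛ i ｝) B)

  else-cong : ∀ b {x y} → (b ≡ false → x ≈ y) → (if b then 0# else x) ≈ (if b then 0# else y)
  else-cong true  eq = refl
  else-cong false eq = eq ≡.refl

  then-cong : ∀ b {x y} → (b ≡ true → x ≈ y) → (if b then x else 0#) ≈ (if b then y else 0#)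
  then-cong true  eq = eq ≡.refl
  then-cong false eq = refl

  -- Sizes and ranks telescope along a chain, so only words with the prescribed length and total
  -- occur. Monotonicity of `rk` makes the truncated subtraction in `increment` exact.
  ∑ᶜ-cong : ∀ m A B {f g} → (∀ r → length r ℕ.+ ∣ A ∣ ≡ ∣ B ∣ → sum r ℕ.+ rk A ≡ rk B → f r ≈ g r) →
            ∑ᶜ m f A B ≈ ∑ᶜ m g A B
  ∑ᶜ-cong m A B {f} {g} eq = go m
    where
    base : (if eqᵇ A B then f [] else 0#) ≈ (if eqᵇ A B then g [] else 0#)
    base = then-cong (eqᵇ A B) λ A≡B → eq [] (cong ∣_∣ (eqᵇ⇒≡ A B A≡B)) (cong rk (eqᵇ⇒≡ A B A≡B))
    go : ∀ m → ∑ᶜ m f A B ≈ ∑ᶜ m g A B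
    go zero    = base
    go (suc m) = +-cong base (∑-cong (allFin n) λ i → else-cong (lookup A i) λ i∉A →
      ∑ᶜ-cong m (A ∪｛ i ｝) B λ r len tot → eq (increment A i ∷ r)
        (≡.trans (≡.sym (≡.trans (cong (length r ℕ.+_) (∣∪｛｝∣ A i i∉A)) (ℕ.+-suc _ _))) len)
        (≡.trans (rank A i (sum r)) tot))
      where
      rank : ∀ A i k → (increment A i ℕ.+ k) ℕ.+ rk A ≡ k ℕ.+ rk (A ∪｛ i ｝)
      rank A i k = ≡.trans (cong (ℕ._+ rk A) (ℕ.+-comm (increment A i) k))
        (≡.trans (ℕ.+-assoc k _ _) (cong (k ℕ.+_) (ℕ.m∸n+n≡m (rk-mono A (A ∪｛ i ｝) (⊆-∪｛｝ A i)))))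

  ∑ᶜ-additive : ∀ {Φ} → Additive Φ → ∀ m f A B → ∑ᶜ m (Φ ∘ f) A B ≈ Φ (∑ᶜ m f A B)
  ∑ᶜ-additive {Φ} Φ-additive = go
    where
    open Additive Φ-additive
    base : ∀ b x → (if b then Φ x else 0#) ≈ Φ (if b then x else 0#)
    base true  x = refl
    base false x = sym Φ-0
    cover : ∀ b {x y} → x ≈ Φ y → (if b then 0# else x) ≈ Φ (if b then 0# else y)
    cover true  eq = sym Φ-0
    cover false eq = eq
    go : ∀ m f A B → ∑ᶜ m (Φ ∘ f) A B ≈ Φ (∑ᶜ m f A B)
    go zero    f A B = base (eqᵇ A B) (f [])
    go (suc m) f A B = trans (+-cong (base (eqᵇ A B) (f []))
        (trans (∑-cong (allFin n) λ i → cover (lookup A i) (go m _ _ B)) (sym (Φ-∑ (allFin n) _))))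
      (sym (Φ-+ _ _))

  ∑ᶜ-*ˡ : ∀ m c f A B → ∑ᶜ m (λ r → c * f r) A B ≈ c * ∑ᶜ m f A B
  ∑ᶜ-*ˡ m c = ∑ᶜ-additive (record { Φ-cong = *-congˡ ; Φ-+ = distribˡ c }) m

  ∑ᶜ-+ : ∀ m f g A B → ∑ᶜ m (λ r → f r + g r) A B ≈ ∑ᶜ m f A B + ∑ᶜ m g A B
  ∑ᶜ-+ zero    f g A B with eqᵇ A B
  ... | true  = refl
  ... | false = sym (+-identityˡ 0#)
  ∑ᶜ-+ (suc m) f g A B = trans (+-cong (∑ᶜ-+ zero f g A B) (trans (∑-cong (allFin n) λ i → cover i (lookup A i)) (∑-+ (allFin n) _ _)))
    (+-interchange _ _ _ _)
    where
    cover : ∀ i b → (if b then 0# else ∑ᶜ m (increment A i ▷ (λ r → f r + g r)) (A ∪｛ i ｝) B)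
         ≈ (if b then 0# else ∑ᶜ m (increment A i ▷ f) (A ∪｛ i ｝) B) + (if b then 0# else ∑ᶜ m (increment A i ▷ g) (A ∪｛ i ｝) B)
    cover i true  = sym (+-identityˡ 0#)
    cover i false = ∑ᶜ-+ m _ _ (A ∪｛ i ｝) B

  ≤-∪｛｝ : ∀ m (A : Subset n) i → lookup A i ≡ false → n ≤ suc m ℕ.+ ∣ A ∣ → n ≤ m ℕ.+ ∣ A ∪｛ i ｝ ∣
  ≤-∪｛｝ m A i i∉A = subst (n ≤_) (≡.sym (≡.trans (cong (m ℕ.+_) (∣∪｛｝∣ A i i∉A)) (ℕ.+-suc m _)))

  ∑-full : ∀ A → n ≤ ∣ A ∣ → (f : Fin n → Carrier) → ∑ (allFin n) (λ i → if lookup A i then 0# else f i) ≈ 0#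
  ∑-full A n≤ f = trans
    (∑-cong (allFin n) λ i → reflexive (cong (if_then 0# else f i) (n≤∣A∣⇒∈ A i n≤))) (∑-0 (allFin n))

  -- Each step adds an element, so a chain from A has at most n - ∣A∣ steps and further fuel
  -- contributes nothing.
  ∑ᶜ-stable : ∀ m k f A B → n ≤ m ℕ.+ ∣ A ∣ → n ≤ k ℕ.+ ∣ A ∣ → ∑ᶜ m f A B ≈ ∑ᶜ k f A B
  ∑ᶜ-stable zero    zero    f A B _  _  = refl
  ∑ᶜ-stable zero    (suc k) f A B n≤ _  = sym (trans (+-congˡ (∑-full A n≤ _)) (+-identityʳ _))
  ∑ᶜ-stable (suc m) zero    f A B _  n≤ = trans (+-congˡ (∑-full A n≤ _)) (+-identityʳ _)
  ∑ᶜ-stable (suc m) (suc k) f A B n≤ n≤' = +-congˡ (∑-cong (allFin n) λ i → else-cong (lookup A i) λ i∉A →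
    ∑ᶜ-stable m k _ (A ∪｛ i ｝) B (≤-∪｛｝ m A i i∉A n≤) (≤-∪｛｝ k A i i∉A n≤'))

  -- Splitting the word of a chain is the same as marking the set C that the chain passes through at
  -- that point. This translates deconcatenation into sums over intermediate subsets. Fuel n is
  -- enough above every C.
  ∑ᶜ-conv : ∀ m f g A B → n ≤ m ℕ.+ ∣ A ∣ →
            ∑ᶜ m (conv f g) A B ≈ ∑ (allSubsets n) (λ C → ∑ᶜ m f A C * ∑ᶜ n g C B)
  ∑ᶜ-conv m f g A B n≤ = go m n≤
    where
    -- The marked set is A itself, the split with empty first part. The other splits are found after
    -- the first cover, by induction.
    first : ∑ (allSubsets n) (λ C → (if eqᵇ A C then f [] else 0#) * ∑ᶜ n g C B) ≈ f [] * ∑ᶜ n g A B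
    first = trans (∑-cong (allSubsets n) λ C → if-* (eqᵇ A C) (∑ᶜ n g C B)) (∑-single A (λ C → f [] * ∑ᶜ n g C B))
      where
      if-* : ∀ b x → (if b then f [] else 0#) * x ≈ (if b then f [] * x else 0#)
      if-* true  x = refl
      if-* false x = zeroˡ x
    unit : ∀ b → (if b then conv f g [] else 0#) ≈ f [] * (if b then g [] else 0#)
    unit true  = +-identityʳ _
    unit false = sym (zeroʳ _)
    go : ∀ m → n ≤ m ℕ.+ ∣ A ∣ → ∑ᶜ m (conv f g) A B ≈ ∑ (allSubsets n) (λ C → ∑ᶜ m f A C * ∑ᶜ n g C B)
    go zero    n≤ = begin
      ∑ᶜ zero (conv f g) A B      ≈⟨ unit (eqᵇ A B) ⟩
      f [] * ∑ᶜ zero g A B        ≈⟨ *-congˡ (∑ᶜ-stable zero n g A B n≤ (ℕ.m≤m+n n _)) ⟩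
      f [] * ∑ᶜ n g A B           ≈⟨ first ⟨
      ∑ (allSubsets n) (λ C → ∑ᶜ zero f A C * ∑ᶜ n g C B) ∎
    go (suc m) n≤ = begin
      ∑ᶜ (suc m) (conv f g) A B
        ≈⟨ +-cong (unit (eqᵇ A B)) (trans (∑-cong (allFin n) λ i → cover i (lookup A i) ≡.refl) (∑-+ (allFin n) _ _)) ⟩
      f [] * (if eqᵇ A B then g [] else 0#) + (∑ (allFin n) (λ i → f [] * above g i B) + ∑ (allFin n) (λ i → ∑ (allSubsets n) (λ C → above f i C * ∑ᶜ n g C B)))
        ≈⟨ +-assoc _ _ _ ⟨
      (f [] * (if eqᵇ A B then g [] else 0#) + ∑ (allFin n) (λ i → f [] * above g i B)) + ∑ (allFin n) (λ i → ∑ (allSubsets n) (λ C → above f i C * ∑ᶜ n g C B))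
        ≈⟨ +-cong (trans (+-congˡ (∑-*ˡ (allFin n) (f []) _)) (sym (distribˡ (f []) _ _))) (∑-swap (allFin n) (allSubsets n) _) ⟩
      f [] * ∑ᶜ (suc m) g A B + ∑ (allSubsets n) (λ C → ∑ (allFin n) (λ i → above f i C * ∑ᶜ n g C B))
        ≈⟨ +-cong (trans (*-congˡ (∑ᶜ-stable (suc m) n g A B n≤ (ℕ.m≤m+n n _))) (sym first)) (∑-cong (allSubsets n) λ C → ∑-*ʳ (allFin n) _ _) ⟩
      ∑ (allSubsets n) (λ C → (if eqᵇ A C then f [] else 0#) * ∑ᶜ n g C B) + ∑ (allSubsets n) (λ C → ∑ (allFin n) (λ i → above f i C) * ∑ᶜ n g C B)
        ≈⟨ ∑-+ (allSubsets n) _ _ ⟨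
      ∑ (allSubsets n) (λ C → (if eqᵇ A C then f [] else 0#) * ∑ᶜ n g C B + ∑ (allFin n) (λ i → above f i C) * ∑ᶜ n g C B)
        ≈⟨ (∑-cong (allSubsets n) λ C → sym (distribʳ (∑ᶜ n g C B) _ _)) ⟩
      ∑ (allSubsets n) (λ C → ∑ᶜ (suc m) f A C * ∑ᶜ n g C B)
        ∎
      where
      above : (Comp → Carrier) → Fin n → Subset n → Carrier
      above h i C = if lookup A i then 0# else ∑ᶜ m (increment A i ▷ h) (A ∪｛ i ｝) C
      cover : ∀ i b → lookup A i ≡ b → (if b then 0# else ∑ᶜ m (increment A i ▷ conv f g) (A ∪｛ i ｝) B)
            ≈ f [] * (if b then 0# else ∑ᶜ m (increment A i ▷ g) (A ∪｛ i ｝) B)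
              + ∑ (allSubsets n) (λ C → (if b then 0# else ∑ᶜ m (increment A i ▷ f) (A ∪｛ i ｝) C) * ∑ᶜ n g C B)
      cover i true  _   = sym (trans (+-cong (zeroʳ _)
        (trans (∑-cong (allSubsets n) λ C → zeroˡ _) (∑-0 (allSubsets n)))) (+-identityˡ 0#))
      cover i false i∉A = begin
        ∑ᶜ m (x ▷ conv f g) A' B
          ≈⟨ ∑ᶜ-cong m A' B (λ r _ _ → reflexive (conv-∷ f g x r)) ⟩
        ∑ᶜ m (λ r → f [] * (x ▷ g) r + conv (x ▷ f) g r) A' B
          ≈⟨ ∑ᶜ-+ m _ _ A' B ⟩
        ∑ᶜ m (λ r → f [] * (x ▷ g) r) A' B + ∑ᶜ m (conv (x ▷ f) g) A' B
          ≈⟨ +-cong (∑ᶜ-*ˡ m (f []) (x ▷ g) A' B) (∑ᶜ-conv m (x ▷ f) g A' B (≤-∪｛｝ m A i i∉A n≤)) ⟩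
        f [] * ∑ᶜ m (x ▷ g) A' B + ∑ (allSubsets n) (λ C → ∑ᶜ m (x ▷ f) A' C * ∑ᶜ n g C B)
          ∎
        where
        x = increment A i
        A' = A ∪｛ i ｝

  -- There are k! saturated chains in an interval of length k.
  ∑ᶜ-length : ∀ m w A B → n ≤ m ℕ.+ ∣ A ∣ →
              ∑ᶜ m (w ∘ length) A B ≈ (if ⊆ᵇ A B then ((∣ B ∣ ∸ ∣ A ∣) !) × w (∣ B ∣ ∸ ∣ A ∣) else 0#)
  ∑ᶜ-length zero    w A B n≤ with eqᵇ A B in eq
  ... | true  rewrite eqᵇ⇒≡ A B eq | ⊆ᵇ-refl B | ℕ.n∸n≡0 ∣ B ∣ = sym (+-identityʳ _)
  ... | false with ⊆ᵇ A B in sub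
  ...   | true  = contradiction (ℕ.≤-trans (⊂ᵇ⇒∣∣< A B sub eq) (∣p∣≤n B)) (ℕ.≤⇒≯ n≤)
  ...   | false = refl
  ∑ᶜ-length (suc m) w A B n≤ = begin
    (if eqᵇ A B then w 0 else 0#) + ∑ (allFin n) (λ i → if lookup A i then 0# else ∑ᶜ m (w ∘ suc ∘ length) (A ∪｛ i ｝) B)
      ≈⟨ +-congˡ (∑-cong (allFin n) λ i → else-cong (lookup A i) λ i∉A →
          trans (∑ᶜ-length m (w ∘ suc) (A ∪｛ i ｝) B (≤-∪｛｝ m A i i∉A n≤))
            (reflexive (cong (λ j → if ⊆ᵇ (A ∪｛ i ｝) B then ((∣ B ∣ ∸ j) !) × w (suc (∣ B ∣ ∸ j)) else 0#) (∣∪｛｝∣ A i i∉A)))) ⟩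
    (if eqᵇ A B then w 0 else 0#) + ∑ (allFin n) (λ i → if lookup A i then 0# else (if ⊆ᵇ (A ∪｛ i ｝) B then c else 0#))
      ≈⟨ cases ⟩
    (if ⊆ᵇ A B then ((∣ B ∣ ∸ ∣ A ∣) !) × w (∣ B ∣ ∸ ∣ A ∣) else 0#)
      ∎
    where
    -- The common contribution of the covers of A inside B; one step is already spent, hence the
    -- shift in w.
    c : Carrier
    c = ((∣ B ∣ ∸ suc ∣ A ∣) !) × w (suc (∣ B ∣ ∸ suc ∣ A ∣))
    cases : (if eqᵇ A B then w 0 else 0#) + ∑ (allFin n) (λ i → if lookup A i then 0# else (if ⊆ᵇ (A ∪｛ i ｝) B then c else 0#))
          ≈ (if ⊆ᵇ A B then ((∣ B ∣ ∸ ∣ A ∣) !) × w (∣ B ∣ ∸ ∣ A ∣) else 0#)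
    cases with ⊆ᵇ A B in sub | eqᵇ A B in eq
    ... | true  | true  = trans (+-congˡ (trans (∑-covers A B sub c) (reflexive (cong (_× c) k≡0))))
                            (reflexive (cong (λ k → (k !) × w k) (≡.sym k≡0)))
      where
      k≡0 : ∣ B ∣ ∸ ∣ A ∣ ≡ 0
      k≡0 = ≡.trans (cong (λ C → ∣ B ∣ ∸ ∣ C ∣) (eqᵇ⇒≡ A B eq)) (ℕ.n∸n≡0 ∣ B ∣)
    ... | true  | false = begin
      0# + ∑ (allFin n) _                                   ≈⟨ +-identityˡ _ ⟩
      ∑ (allFin n) _                                        ≈⟨ ∑-covers A B sub c ⟩
      (∣ B ∣ ∸ ∣ A ∣) × c                                   ≡⟨ cong (_× c) k≡ ⟩
      suc k × ((k !) × w (suc k))                           ≈⟨ ×-assocˡ (w (suc k)) (suc k) (k !) ⟩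
      (suc k !) × w (suc k)                                 ≡⟨ cong (λ k → (k !) × w k) k≡ ⟨
      ((∣ B ∣ ∸ ∣ A ∣) !) × w (∣ B ∣ ∸ ∣ A ∣)               ∎
      where
      k = ∣ B ∣ ∸ suc ∣ A ∣
      k≡ : ∣ B ∣ ∸ ∣ A ∣ ≡ suc k
      k≡ = ℕ.+-∸-assoc 1 (⊂ᵇ⇒∣∣< A B sub eq)
    ... | false | true  = contradiction (≡.trans (≡.sym (⊆ᵇ-refl A)) (≡.trans (cong (⊆ᵇ A) (eqᵇ⇒≡ A B eq)) sub)) λ ()
    ... | false | false = trans (+-identityˡ _) (trans (∑-cong (allFin n) vanish) (∑-0 (allFin n)))
      where
      vanish : ∀ i → (if lookup A i then 0# else (if ⊆ᵇ (A ∪｛ i ｝) B then c else 0#)) ≈ 0#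
      vanish i rewrite ⊈ᵇ-∪｛｝ A B i sub with lookup A i
      ... | true  = refl
      ... | false = refl

  -- `rseqs` stops when its fuel is spent, without looking at the set; under the hypothesis this
  -- happens exactly at the full set. `∑ᶜ` instead tests at every stage whether its target is
  -- reached.
  ∑-rseqs : ∀ k f A → k ℕ.+ ∣ A ∣ ≡ n → ∑ (rseqs rk k A) f ≈ ∑ᶜ k f A ⊤
  ∑-rseqs zero    f A full = trans (+-identityʳ _) (reflexive (cong (if_then f [] else 0#) (≡.sym A≡⊤)))
    where
    A≡⊤ : eqᵇ A ⊤ ≡ true
    A≡⊤ = ≡.trans (cong (λ C → eqᵇ C ⊤) (∣p∣≡n⇒p≡⊤ {p = A} full)) (eqᵇ-refl (⊤ {n}))
  ∑-rseqs (suc k) f A len  = begin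
    ∑ (rseqs rk (suc k) A) f
      ≈⟨ ∑-concatMap _ (allFin n) f ⟩
    ∑ (allFin n) (λ i → ∑ (if lookup A i then [] else map (increment A i ∷_) (rseqs rk k (A ∪｛ i ｝))) f)
      ≈⟨ (∑-cong (allFin n) λ i → cover i (lookup A i) ≡.refl) ⟩
    ∑ (allFin n) (λ i → if lookup A i then 0# else ∑ᶜ k (increment A i ▷ f) (A ∪｛ i ｝) ⊤)
      ≈⟨ +-identityˡ _ ⟨
    0# + ∑ (allFin n) (λ i → if lookup A i then 0# else ∑ᶜ k (increment A i ▷ f) (A ∪｛ i ｝) ⊤)
      ≡⟨ cong (λ b → (if b then f [] else 0#) + ∑ (allFin n) (λ i → if lookup A i then 0# else ∑ᶜ k (increment A i ▷ f) (A ∪｛ i ｝) ⊤)) A≢⊤ ⟨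
    ∑ᶜ (suc k) f A ⊤
      ∎
    where
    A≢⊤ : eqᵇ A ⊤ ≡ false
    A≢⊤ with eqᵇ A ⊤ in eq
    ... | false = ≡.refl
    ... | true  = contradiction (≡.trans (cong ∣_∣ (eqᵇ⇒≡ A ⊤ eq)) (≡.trans (∣⊤∣≡n n) (≡.sym len))) (ℕ.m≢1+n+m ∣ A ∣)
    cover : ∀ i b → lookup A i ≡ b → ∑ (if b then [] else map (increment A i ∷_) (rseqs rk k (A ∪｛ i ｝))) f
         ≈ (if b then 0# else ∑ᶜ k (increment A i ▷ f) (A ∪｛ i ｝) ⊤)
    cover i true  _   = refl
    cover i false i∉A = trans (reflexive (∑-map (increment A i ∷_) (rseqs rk k (A ∪｛ i ｝)) f))
      (∑-rseqs k _ (A ∪｛ i ｝) (≡.trans (cong (k ℕ.+_) (∣∪｛｝∣ A i i∉A)) (≡.trans (ℕ.+-suc k _) len)))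

-- The series σ is given by its truncations σ N.
module Homomorphism
  (R : CommutativeRing 0ℓ 0ℓ)
  (tr : ℕ → CommutativeRing.Carrier R → CommutativeRing.Carrier R)
  (tr-isTruncation : IsTruncation R tr)
  (σ : ℕ → CommutativeRing.Carrier R)
  (σ-stable : ∀ d k → CommutativeRing._≈_ R (tr (suc d) (σ (k ℕ.+ d))) (tr (suc d) (σ d)))
  (ι : ℕ → CommutativeRing.Carrier R)
  (ι-inverse : Characters.IsInverseFactorial R ι)
  (q t : CommutativeRing.Carrier R)
  where

  open Sums R
  open Characters R
  open Birkhoff R tr tr-isTruncation
  open IsTruncation tr-isTruncation
  open SubsetSums R

  sgn : ℕ → Carrier
  sgn zero    = 1#
  sgn (suc k) = - sgn k

  sgn≈^ : ∀ k → sgn k ≈ (- 1#) ^ k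
  sgn≈^ zero    = refl
  sgn≈^ (suc k) = begin
    - sgn k             ≈⟨ -‿cong (*-identityˡ _) ⟨
    - (1# * sgn k)      ≈⟨ -‿distribˡ-* 1# (sgn k) ⟩
    - 1# * sgn k        ≈⟨ *-congˡ (sgn≈^ k) ⟩
    - 1# * (- 1#) ^ k   ∎

  χ : ℕ → Comp → Carrier
  χ N = twist (λ x → - 1# * σ N ^ x) (ι ∘ length)

  χ-character : ∀ N → IsCharacter (χ N)
  χ-character N = twist-character _ (inverseFactorial-character ι-inverse)

  χ-stable : ∀ d k r → tr (suc d) (χ (k ℕ.+ d) r) ≈ tr (suc d) (χ d r)
  χ-stable d k r = tr-*-cong (suc d)
    (tr-weight-cong (suc d) (λ x → tr-*-cong (suc d) refl (tr-^-cong (suc d) (σ-stable d k) x)) r) refl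

  open Factorisation χ χ-character χ-stable

  τ : Comp → Carrier
  τ = conv (twist (λ x → t * q ^ x) π) (ι ∘ length)

  τ-character : IsCharacter τ
  τ-character = conv-character (twist-character _ π-character) (inverseFactorial-character ι-inverse)

  module _ {n : ℕ} (rk : Subset n → ℕ) (rk-⊥ : rk ⊥ ≡ 0) (rk-mono : ∀ A B → A ⊆ B → rk A ≤ rk B) where
    open Chains R rk rk-mono

    -- The recursion of 𝒫[X|_A].
    record IsRecursive (P : ℕ → Subset n → Carrier) : Set where
      field
        P-∅   : ∀ k A → ∣ A ∣ ≡ 0 → P k A ≈ 1#
        P-suc : ∀ k A d → ∣ A ∣ ≡ suc d →
          P (suc k) A ≈ tr (suc d) (- ∑ (properSubsets A) (λ C → P k C * σ d ^ (rk A ∸ rk C) * sgn (suc d ∸ ∣ C ∣)))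

    interval : ℕ → Subset n → Subset n → Carrier
    interval d C A = σ d ^ (rk A ∸ rk C) * (- 1#) ^ (∣ A ∣ ∸ ∣ C ∣)

    -- All chains from C to A have the same length and the same total, so χ takes one value on them,
    -- and the k! chains cancel its denominator. Removing the unit discards C = A.
    ∑ᶜ-χ : ∀ d C A → ∑ᶜ n (removeUnit (χ d)) C A ≈ (if ⊆ᵇ C A ∧ not (eqᵇ C A) then interval d C A else 0#)
    ∑ᶜ-χ d C A = begin
      ∑ᶜ n (removeUnit (χ d)) C A
        ≈⟨ ∑ᶜ-cong n C A separate ⟩
      ∑ᶜ n (λ r → interval d C A * ι⁺ (length r)) C A
        ≈⟨ ∑ᶜ-*ˡ n (interval d C A) (ι⁺ ∘ length) C A ⟩
      interval d C A * ∑ᶜ n (ι⁺ ∘ length) C A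
        ≈⟨ *-congˡ (∑ᶜ-length n ι⁺ C A (ℕ.m≤m+n n _)) ⟩
      interval d C A * (if ⊆ᵇ C A then ((∣ A ∣ ∸ ∣ C ∣) !) × ι⁺ (∣ A ∣ ∸ ∣ C ∣) else 0#)
        ≈⟨ cases ⟩
      (if ⊆ᵇ C A ∧ not (eqᵇ C A) then interval d C A else 0#)
        ∎
      where
      -- The value 0 at 0 absorbs `removeUnit`, leaving a function of the length alone to which
      -- `∑ᶜ-length` applies.
      ι⁺ : ℕ → Carrier
      ι⁺ zero    = 0#
      ι⁺ (suc k) = ι (suc k)
      separate : ∀ r → length r ℕ.+ ∣ C ∣ ≡ ∣ A ∣ → sum r ℕ.+ rk C ≡ rk A →
                 removeUnit (χ d) r ≈ interval d C A * ι⁺ (length r)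
      separate []      _   _   = sym (zeroʳ _)
      separate (x ∷ r) len tot = *-congʳ (begin
        weight (λ x → - 1# * σ d ^ x) (x ∷ r)           ≈⟨ weight-geometric (- 1#) (σ d) (x ∷ r) ⟩
        (- 1#) ^ length (x ∷ r) * σ d ^ sum (x ∷ r)     ≈⟨ *-comm _ _ ⟩
        σ d ^ sum (x ∷ r) * (- 1#) ^ length (x ∷ r)     ≡⟨ cong₂ (λ i j → σ d ^ i * (- 1#) ^ j) (difference (sum (x ∷ r)) (rk C) tot) (difference (length (x ∷ r)) ∣ C ∣ len) ⟩
        interval d C A                                  ∎)
        where
        difference : ∀ i j {k} → i ℕ.+ j ≡ k → i ≡ k ∸ j
        difference i j ≡.refl = ≡.sym (ℕ.m+n∸n≡m i j)
      cases : interval d C A * (if ⊆ᵇ C A then ((∣ A ∣ ∸ ∣ C ∣) !) × ι⁺ (∣ A ∣ ∸ ∣ C ∣) else 0#)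
            ≈ (if ⊆ᵇ C A ∧ not (eqᵇ C A) then interval d C A else 0#)
      cases with ⊆ᵇ C A in sub | eqᵇ C A in eq
      ... | false | _     = zeroʳ _
      ... | true  | true  rewrite eqᵇ⇒≡ C A eq | ℕ.n∸n≡0 ∣ A ∣ = trans (*-congˡ (+-identityˡ 0#)) (zeroʳ _)
      ... | true  | false = trans (*-congˡ inverse) (*-identityʳ _)
        where
        inverse : ((∣ A ∣ ∸ ∣ C ∣) !) × ι⁺ (∣ A ∣ ∸ ∣ C ∣) ≈ 1#
        inverse with ∣ A ∣ ∸ ∣ C ∣ | ℕ.m<n⇒0<n∸m (⊂ᵇ⇒∣∣< C A sub eq)
        ... | suc k | _ = ι-inverse (suc k)

    ∑ᶜ-π-∅ : ∀ k A → ∣ A ∣ ≡ 0 → ∑ᶜ n (πᶠ k) ⊥ A ≈ 1#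
    ∑ᶜ-π-∅ k A ∣A∣≡0 = begin
      ∑ᶜ n (πᶠ k) ⊥ A         ≈⟨ ∑ᶜ-cong n ⊥ A (λ r len _ → π≈1 k r (≡.trans len ∣A∣≡0)) ⟩
      ∑ᶜ n (λ _ → 1#) ⊥ A     ≈⟨ ∑ᶜ-length n (λ _ → 1#) ⊥ A (ℕ.m≤m+n n _) ⟩
      (if ⊆ᵇ ⊥ A then ((∣ A ∣ ∸ ∣ ⊥ {n} ∣) !) × 1# else 0#)
                              ≡⟨ cong₂ (λ b j → if b then ((j ∸ ∣ ⊥ {n} ∣) !) × 1# else 0#) (⊥-⊆ᵇ A) ∣A∣≡0 ⟩
      ((0 ∸ ∣ ⊥ {n} ∣) !) × 1#  ≡⟨ cong (λ j → (j !) × 1#) (ℕ.0∸n≡0 ∣ ⊥ {n} ∣) ⟩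
      1# + 0#                 ≈⟨ +-identityʳ 1# ⟩
      1#                      ∎
      where
      π≈1 : ∀ k r → length r ℕ.+ ∣ ⊥ {n} ∣ ≡ 0 → πᶠ k r ≈ 1#
      π≈1 zero    []      _ = refl
      π≈1 (suc k) []      _ = refl

    -- All chains from ∅ to A have length suc d, so their words are truncated at the same degree and
    -- with the same `χ d`. By additivity the truncation leaves the sum, and the convolution inside
    -- becomes a sum over the sets C.
    ∑ᶜ-π-suc : ∀ k A d → ∣ A ∣ ≡ suc d →
      ∑ᶜ n (πᶠ (suc k)) ⊥ A ≈ - tr (suc d) (∑ (properSubsets A) (λ C → ∑ᶜ n (πᶠ k) ⊥ C * interval d C A))
    ∑ᶜ-π-suc k A d ∣A∣≡ = begin
      ∑ᶜ n (πᶠ (suc k)) ⊥ A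
        ≈⟨ ∑ᶜ-cong n ⊥ A unfold ⟩
      ∑ᶜ n (λ r → - tr (suc d) (conv (πᶠ k) (removeUnit (χ d)) r)) ⊥ A
        ≈⟨ ∑ᶜ-additive neg-additive n _ ⊥ A ⟩
      - ∑ᶜ n (λ r → tr (suc d) (conv (πᶠ k) (removeUnit (χ d)) r)) ⊥ A
        ≈⟨ -‿cong (∑ᶜ-additive (tr-additive (suc d)) n _ ⊥ A) ⟩
      - tr (suc d) (∑ᶜ n (conv (πᶠ k) (removeUnit (χ d))) ⊥ A)
        ≈⟨ -‿cong (tr-cong (suc d) sum≈) ⟩
      - tr (suc d) (∑ (properSubsets A) (λ C → ∑ᶜ n (πᶠ k) ⊥ C * interval d C A))
        ∎
      where
      unfold : ∀ r → length r ℕ.+ ∣ ⊥ {n} ∣ ≡ ∣ A ∣ → sum r ℕ.+ rk ⊥ ≡ rk A →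
               πᶠ (suc k) r ≈ - tr (suc d) (conv (πᶠ k) (removeUnit (χ d)) r)
      -- The equation forces r to be nonempty with a tail of length d, the case in which the
      -- recursive clause of `πᶠ` fires with this d.
      unfold r len _ with ≡.trans (≡.trans (≡.sym (ℕ.+-identityʳ _)) (≡.trans (cong (length r ℕ.+_) (≡.sym (∣⊥∣≡0 n))) len)) ∣A∣≡
      unfold (x ∷ r) len _ | ≡.refl = refl
      *-if : ∀ b x y → x * (if b then y else 0#) ≈ (if b then x * y else 0#)
      *-if true  x y = refl
      *-if false x y = zeroʳ x
      sum≈ : ∑ᶜ n (conv (πᶠ k) (removeUnit (χ d))) ⊥ A ≈ ∑ (properSubsets A) (λ C → ∑ᶜ n (πᶠ k) ⊥ C * interval d C A)
      sum≈ = trans (∑ᶜ-conv n (πᶠ k) _ ⊥ A (ℕ.m≤m+n n _))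
        (trans (∑-cong (allSubsets n) λ C → trans (*-congˡ (∑ᶜ-χ d C A)) (*-if (⊆ᵇ C A ∧ not (eqᵇ C A)) _ _))
          (sym (∑-filter (λ C → ⊆ᵇ C A ∧ not (eqᵇ C A)) (allSubsets n) _)))

    ∑ᶜ-π : ∀ {P} → IsRecursive P → ∀ k A → ∣ A ∣ ≤ k → P k A ≈ ∑ᶜ n (πᶠ k) ⊥ A
    ∑ᶜ-π {P} P-rec = go
      where
      open IsRecursive P-rec
      go : ∀ k A → ∣ A ∣ ≤ k → P k A ≈ ∑ᶜ n (πᶠ k) ⊥ A
      step : ∀ k A {j} → ∣ A ∣ ≡ j → j ≤ k → P k A ≈ ∑ᶜ n (πᶠ k) ⊥ A
      go k A = step k A ≡.refl
      step k       A {zero}  ∣A∣≡0 _         = trans (P-∅ k A ∣A∣≡0) (sym (∑ᶜ-π-∅ k A ∣A∣≡0))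
      step (suc k) A {suc d} ∣A∣≡  (s≤s d≤k) = begin
        P (suc k) A
          ≈⟨ P-suc k A d ∣A∣≡ ⟩
        tr (suc d) (- ∑ (properSubsets A) (λ C → P k C * σ d ^ (rk A ∸ rk C) * sgn (suc d ∸ ∣ C ∣)))
          ≈⟨ Tr.Φ-neg (suc d) _ ⟩
        - tr (suc d) (∑ (properSubsets A) (λ C → P k C * σ d ^ (rk A ∸ rk C) * sgn (suc d ∸ ∣ C ∣)))
          ≈⟨ -‿cong (tr-cong (suc d) terms) ⟩
        - tr (suc d) (∑ (properSubsets A) (λ C → ∑ᶜ n (πᶠ k) ⊥ C * interval d C A))
          ≈⟨ ∑ᶜ-π-suc k A d ∣A∣≡ ⟨
        ∑ᶜ n (πᶠ (suc k)) ⊥ A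
          ∎
        where
        proper : Subset n → Bool
        proper C = ⊆ᵇ C A ∧ not (eqᵇ C A)
        smaller : ∀ C → proper C ≡ true → ∣ C ∣ ≤ k
        smaller C eq with ⊆ᵇ C A in sub | eqᵇ C A in neq
        ... | true | false = ℕ.≤-trans (s≤s⁻¹ (subst (∣ C ∣ <_) ∣A∣≡ (⊂ᵇ⇒∣∣< C A sub neq))) d≤k
        terms : ∑ (properSubsets A) (λ C → P k C * σ d ^ (rk A ∸ rk C) * sgn (suc d ∸ ∣ C ∣))
              ≈ ∑ (properSubsets A) (λ C → ∑ᶜ n (πᶠ k) ⊥ C * interval d C A)
        terms = trans (∑-filter proper (allSubsets n) _) (trans
          (∑-cong (allSubsets n) λ C → then-cong (proper C) λ eq → trans (*-assoc _ _ _)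
            (*-cong (go k C (smaller C eq)) (*-congˡ (trans (sgn≈^ (suc d ∸ ∣ C ∣)) (reflexive (cong (λ j → (- 1#) ^ (j ∸ ∣ C ∣)) (≡.sym ∣A∣≡)))))))
          (sym (∑-filter proper (allSubsets n) _)))

    -- A chain is cut at a set A. The part below yields the summand of ℋ belonging to A; the part
    -- above yields 1, as each of its k! chains weighs 1/k!.
    ∑-τ-rseqs : ∀ {P} → IsRecursive P → ∑ (rseqs rk n ⊥) τ ≈ ∑ (allSubsets n) (λ A → P n A * q ^ rk A * t ^ ∣ A ∣)
    ∑-τ-rseqs {P} P-rec = begin
      ∑ (rseqs rk n ⊥) τ
        ≈⟨ ∑-rseqs n τ ⊥ (≡.trans (cong (n ℕ.+_) (∣⊥∣≡0 n)) (ℕ.+-identityʳ n)) ⟩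
      ∑ᶜ n τ ⊥ ⊤
        ≈⟨ ∑ᶜ-conv n (twist (λ x → t * q ^ x) π) (ι ∘ length) ⊥ ⊤ (ℕ.m≤m+n n _) ⟩
      ∑ (allSubsets n) (λ A → ∑ᶜ n (twist (λ x → t * q ^ x) π) ⊥ A * ∑ᶜ n (ι ∘ length) A ⊤)
        ≈⟨ (∑-cong (allSubsets n) λ A → trans (*-cong (lower A) (upper A)) (rearrange (t ^ ∣ A ∣) (q ^ rk A) _)) ⟩
      ∑ (allSubsets n) (λ A → ∑ᶜ n (πᶠ n) ⊥ A * q ^ rk A * t ^ ∣ A ∣)
        ≈⟨ (∑-cong (allSubsets n) λ A → *-congʳ (*-congʳ (∑ᶜ-π P-rec n A (∣p∣≤n A)))) ⟨
      ∑ (allSubsets n) (λ A → P n A * q ^ rk A * t ^ ∣ A ∣)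
        ∎
      where
      rearrange : ∀ x y z → ((x * y) * z) * 1# ≈ z * y * x
      rearrange x y z = trans (*-identityʳ _) (trans (*-comm _ z) (trans (*-congˡ (*-comm x y)) (sym (*-assoc z y x))))
      upper : ∀ A → ∑ᶜ n (ι ∘ length) A ⊤ ≈ 1#
      upper A = trans (∑ᶜ-length n ι A ⊤ (ℕ.m≤m+n n _))
        (trans (reflexive (cong (if_then (k !) × ι k else 0#) (⊆ᵇ-⊤ A))) (ι-inverse k))
        where k = ∣ ⊤ {n} ∣ ∸ ∣ A ∣
      lower : ∀ A → ∑ᶜ n (twist (λ x → t * q ^ x) π) ⊥ A ≈ (t ^ ∣ A ∣ * q ^ rk A) * ∑ᶜ n (πᶠ n) ⊥ A
      lower A = trans (∑ᶜ-cong n ⊥ A separate) (∑ᶜ-*ˡ n _ (πᶠ n) ⊥ A)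
        where
        separate : ∀ r → length r ℕ.+ ∣ ⊥ {n} ∣ ≡ ∣ A ∣ → sum r ℕ.+ rk ⊥ ≡ rk A →
                   twist (λ x → t * q ^ x) π r ≈ (t ^ ∣ A ∣ * q ^ rk A) * πᶠ n r
        separate r len tot = *-cong
          (trans (weight-geometric t q r) (reflexive (cong₂ (λ i j → t ^ i * q ^ j) len' tot')))
          (πᶠ-stable (length r) n r ℕ.≤-refl (subst (_≤ n) (≡.sym len') (∣p∣≤n A)))
          where
          len' : length r ≡ ∣ A ∣
          len' = ≡.trans (≡.sym (≡.trans (cong (length r ℕ.+_) (∣⊥∣≡0 n)) (ℕ.+-identityʳ _))) len
          tot' : sum r ≡ rk A
          tot' = ≡.trans (≡.sym (≡.trans (cong (sum r ℕ.+_) rk-⊥) (ℕ.+-identityʳ _))) tot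

-- The polynomial ring ℚ[q, t, e₁, e₂, …]

open import Defs
open import Data.Product using (Σ; _×_)
open import Algebra.Properties.CommutativeSemigroup ℕ.+-commutativeSemigroup using (interchange)
open ≡ using (refl; sym; trans)

ℚ-ring : AlmostCommutativeRing 0ℓ 0ℓ
ℚ-ring = fromCommutativeRing ℚ.+-*-commutativeRing (λ x → dec⇒maybe (0ℚ ℚ.≟ x))

exponent : Mono → ℕ → ℕ
exponent []      i       = 0
exponent (x ∷ m) zero    = x
exponent (x ∷ m) (suc i) = exponent m i

infix 4 _≐_
-- Lists that differ by trailing zeros denote one monomial. Comparing all exponents expresses this
-- without cases and is evidently an equivalence.
_≐_ : Mono → Mono → Set
m ≐ m' = ∀ i → exponent m i ≡ exponent m' i

∧-true : ∀ {a b} → (a ∧ b) ≡ true → a ≡ true × b ≡ true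
∧-true {true} {true} _ = refl , refl

≡ᵇ-true : ∀ x y → (x ≡ᵇ y) ≡ true → x ≡ y
≡ᵇ-true x y = ℕ.≡ᵇ⇒≡ x y ∘ Equivalence.from T-≡

≡ᵇ-refl : ∀ x → (x ≡ᵇ x) ≡ true
≡ᵇ-refl x = Equivalence.to T-≡ (ℕ.≡⇒≡ᵇ x x refl)

monoEq⇒≐ : ∀ m m' → monoEq m m' ≡ true → m ≐ m'
monoEq⇒≐ []      []       eq i       = refl
monoEq⇒≐ []      (y ∷ m') eq zero    = sym (≡ᵇ-true y 0 (proj₁ (∧-true eq)))
monoEq⇒≐ []      (y ∷ m') eq (suc i) = monoEq⇒≐ [] m' (proj₂ (∧-true {y ≡ᵇ 0} eq)) i
monoEq⇒≐ (x ∷ m) []       eq zero    = ≡ᵇ-true x 0 (proj₁ (∧-true eq))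
monoEq⇒≐ (x ∷ m) []       eq (suc i) = monoEq⇒≐ m [] (proj₂ (∧-true {x ≡ᵇ 0} eq)) i
monoEq⇒≐ (x ∷ m) (y ∷ m') eq zero    = ≡ᵇ-true x y (proj₁ (∧-true eq))
monoEq⇒≐ (x ∷ m) (y ∷ m') eq (suc i) = monoEq⇒≐ m m' (proj₂ (∧-true {x ≡ᵇ y} eq)) i

≐⇒monoEq : ∀ m m' → m ≐ m' → monoEq m m' ≡ true
≐⇒monoEq []      []       eq = refl
≐⇒monoEq []      (y ∷ m') eq rewrite sym (eq 0) = ≐⇒monoEq [] m' (eq ∘ suc)
≐⇒monoEq (x ∷ m) []       eq rewrite eq 0 = ≐⇒monoEq m [] (eq ∘ suc)
≐⇒monoEq (x ∷ m) (y ∷ m') eq rewrite eq 0 | ≡ᵇ-refl y = ≐⇒monoEq m m' (eq ∘ suc)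

exponent-monoMul : ∀ m m' i → exponent (monoMul m m') i ≡ exponent m i ℕ.+ exponent m' i
exponent-monoMul []      m'       i       = refl
exponent-monoMul (x ∷ m) []       i       = sym (ℕ.+-identityʳ _)
exponent-monoMul (x ∷ m) (y ∷ m') zero    = refl
exponent-monoMul (x ∷ m) (y ∷ m') (suc i) = exponent-monoMul m m' i

monoMul-cong : ∀ {m n m' n'} → m ≐ n → m' ≐ n' → monoMul m m' ≐ monoMul n n'
monoMul-cong {m} {n} {m'} {n'} p p' i = begin
  exponent (monoMul m m') i        ≡⟨ exponent-monoMul m m' i ⟩
  exponent m i ℕ.+ exponent m' i   ≡⟨ cong₂ ℕ._+_ (p i) (p' i) ⟩
  exponent n i ℕ.+ exponent n' i   ≡⟨ exponent-monoMul n n' i ⟨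
  exponent (monoMul n n') i        ∎
  where open ≡.≡-Reasoning

monoMul-comm : ∀ m m' → monoMul m m' ≡ monoMul m' m
monoMul-comm []      []       = refl
monoMul-comm []      (y ∷ m') = refl
monoMul-comm (x ∷ m) []       = refl
monoMul-comm (x ∷ m) (y ∷ m') = cong₂ _∷_ (ℕ.+-comm x y) (monoMul-comm m m')

monoMul-assoc : ∀ l m n → monoMul (monoMul l m) n ≡ monoMul l (monoMul m n)
monoMul-assoc []      m       n       = refl
monoMul-assoc (x ∷ l) []      n       = refl
monoMul-assoc (x ∷ l) (y ∷ m) []      = refl
monoMul-assoc (x ∷ l) (y ∷ m) (z ∷ n) = cong₂ _∷_ (ℕ.+-assoc x y z) (monoMul-assoc l m n)

Respects≐ : (Mono → ℚ) → Set
Respects≐ φ = ∀ m m' → m ≐ m' → φ m ≡ φ m'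

-- The linear functional with values φ on monomials.  Equality of
-- coefficients amounts to equality under all functionals that respect
-- _≐_, and under these the ring axioms become identities of finite sums.
⟪_⟫ : (Mono → ℚ) → SymQT → ℚ
⟪ φ ⟫ []            = 0ℚ
⟪ φ ⟫ ((c , m) ∷ p) = c ℚ.* φ m ℚ.+ ⟪ φ ⟫ p

⟪⟫-cong : ∀ {φ ψ} → (∀ m → φ m ≡ ψ m) → ∀ p → ⟪ φ ⟫ p ≡ ⟪ ψ ⟫ p
⟪⟫-cong eq []            = refl
⟪⟫-cong eq ((c , m) ∷ p) = cong₂ ℚ._+_ (cong (c ℚ.*_) (eq m)) (⟪⟫-cong eq p)

⟪⟫-⊕ : ∀ φ p q → ⟪ φ ⟫ (p ⊕ q) ≡ ⟪ φ ⟫ p ℚ.+ ⟪ φ ⟫ q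
⟪⟫-⊕ φ []            q = sym (ℚ.+-identityˡ _)
⟪⟫-⊕ φ ((c , m) ∷ p) q = begin
  c ℚ.* φ m ℚ.+ ⟪ φ ⟫ (p ⊕ q)                ≡⟨ cong (c ℚ.* φ m ℚ.+_) (⟪⟫-⊕ φ p q) ⟩
  c ℚ.* φ m ℚ.+ (⟪ φ ⟫ p ℚ.+ ⟪ φ ⟫ q)       ≡⟨ ℚ.+-assoc (c ℚ.* φ m) _ _ ⟨
  c ℚ.* φ m ℚ.+ ⟪ φ ⟫ p ℚ.+ ⟪ φ ⟫ q         ∎
  where open ≡.≡-Reasoning

⟪⟫-scale : ∀ φ a p → ⟪ φ ⟫ (scale a p) ≡ a ℚ.* ⟪ φ ⟫ p
⟪⟫-scale φ a []            = sym (ℚ.*-zeroʳ a)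
⟪⟫-scale φ a ((c , m) ∷ p) =
  trans (cong₂ ℚ._+_ (ℚ.*-assoc a c (φ m)) (⟪⟫-scale φ a p)) (sym (ℚ.*-distribˡ-+ a _ _))

⟪⟫-mulMono : ∀ φ c m q → ⟪ φ ⟫ (map (λ { (d , m') → (c ℚ.* d , monoMul m m') }) q)
                       ≡ c ℚ.* ⟪ (λ m' → φ (monoMul m m')) ⟫ q
⟪⟫-mulMono φ c m []             = sym (ℚ.*-zeroʳ c)
⟪⟫-mulMono φ c m ((d , m') ∷ q) =
  trans (cong₂ ℚ._+_ (ℚ.*-assoc c d (φ (monoMul m m'))) (⟪⟫-mulMono φ c m q)) (sym (ℚ.*-distribˡ-+ c _ _))

⟪⟫-⊗ : ∀ φ p q → ⟪ φ ⟫ (p ⊗ q) ≡ ⟪ (λ m → ⟪ (λ m' → φ (monoMul m m')) ⟫ q) ⟫ p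
⟪⟫-⊗ φ []            q = refl
⟪⟫-⊗ φ ((c , m) ∷ p) q =
  trans (⟪⟫-⊕ φ (map _ q) (p ⊗ q)) (cong₂ ℚ._+_ (⟪⟫-mulMono φ c m q) (⟪⟫-⊗ φ p q))

⟪⟫-0 : ∀ p → ⟪ (λ _ → 0ℚ) ⟫ p ≡ 0ℚ
⟪⟫-0 []            = refl
⟪⟫-0 ((c , m) ∷ p) = cong₂ ℚ._+_ (ℚ.*-zeroʳ c) (⟪⟫-0 p)

⟪⟫-linear : ∀ a φ ψ p → ⟪ (λ m → a ℚ.* φ m ℚ.+ ψ m) ⟫ p ≡ a ℚ.* ⟪ φ ⟫ p ℚ.+ ⟪ ψ ⟫ p
⟪⟫-linear a φ ψ []            = sym (cong (ℚ._+ 0ℚ) (ℚ.*-zeroʳ a))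
⟪⟫-linear a φ ψ ((c , m) ∷ p) =
  trans (cong (c ℚ.* (a ℚ.* φ m ℚ.+ ψ m) ℚ.+_) (⟪⟫-linear a φ ψ p)) (rearrange a c _ _ _ _)
  where
  rearrange : ∀ a c x y u v → c ℚ.* (a ℚ.* x ℚ.+ y) ℚ.+ (a ℚ.* u ℚ.+ v)
                            ≡ a ℚ.* (c ℚ.* x ℚ.+ u) ℚ.+ (c ℚ.* y ℚ.+ v)
  rearrange = solve-∀ ℚ-ring

⟪⟫-swap : ∀ (Φ : Mono → Mono → ℚ) p q →
          ⟪ (λ m → ⟪ Φ m ⟫ q) ⟫ p ≡ ⟪ (λ m' → ⟪ (λ m → Φ m m') ⟫ p) ⟫ q
⟪⟫-swap Φ []            q = sym (⟪⟫-0 q)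
⟪⟫-swap Φ ((c , m) ∷ p) q =
  trans (cong (c ℚ.* ⟪ Φ m ⟫ q ℚ.+_) (⟪⟫-swap Φ p q)) (sym (⟪⟫-linear c (Φ m) _ q))

indicator : Mono → Mono → ℚ
indicator m m' = if monoEq m' m then 1ℚ else 0ℚ

coeff≡⟪indicator⟫ : ∀ p m → coeff p m ≡ ⟪ indicator m ⟫ p
coeff≡⟪indicator⟫ []             m = refl
coeff≡⟪indicator⟫ ((c , m') ∷ p) m = cong₂ ℚ._+_ head≡ (coeff≡⟪indicator⟫ p m)
  where
  head≡ : (if monoEq m' m then c else 0ℚ) ≡ c ℚ.* indicator m m'
  head≡ with monoEq m' m
  ... | true  = sym (ℚ.*-identityʳ c)
  ... | false = sym (ℚ.*-zeroʳ c)

Bool-ext : ∀ {a b} → (a ≡ true → b ≡ true) → (b ≡ true → a ≡ true) → a ≡ b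
Bool-ext {true}  {b}     f g = sym (f refl)
Bool-ext {false} {true}  f g = g refl
Bool-ext {false} {false} f g = refl

monoEq-cong : ∀ l m l' m' → l ≐ l' → m ≐ m' → monoEq l m ≡ monoEq l' m'
monoEq-cong l m l' m' p q = Bool-ext
  (λ eq → ≐⇒monoEq l' m' (λ i → trans (sym (p i)) (trans (monoEq⇒≐ l m eq i) (q i))))
  (λ eq → ≐⇒monoEq l m (λ i → trans (p i) (trans (monoEq⇒≐ l' m' eq i) (sym (q i)))))

indicator-respects : ∀ m → Respects≐ (indicator m)
indicator-respects m l l' eq = cong (if_then 1ℚ else 0ℚ) (monoEq-cong l m l' m eq (λ _ → refl))

coeff-⊕ : ∀ p q m → coeff (p ⊕ q) m ≡ coeff p m ℚ.+ coeff q m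
coeff-⊕ p q m rewrite coeff≡⟪indicator⟫ (p ⊕ q) m | coeff≡⟪indicator⟫ p m | coeff≡⟪indicator⟫ q m =
  ⟪⟫-⊕ (indicator m) p q

coeff-scale : ∀ a p m → coeff (scale a p) m ≡ a ℚ.* coeff p m
coeff-scale a p m rewrite coeff≡⟪indicator⟫ (scale a p) m | coeff≡⟪indicator⟫ p m =
  ⟪⟫-scale (indicator m) a p

-- Selecting the terms whose monomial satisfies a Boolean test

keep : (Mono → Bool) → SymQT → SymQT
keep b []            = []
keep b ((c , m) ∷ p) = if b m then (c , m) ∷ keep b p else keep b p

length-keep : ∀ b p → length (keep b p) ≤ length p
length-keep b []            = z≤n
length-keep b ((c , m) ∷ p) with b m
... | true  = s≤s (length-keep b p)
... | false = ℕ.m≤n⇒m≤1+n (length-keep b p)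

⟪⟫-keep : ∀ φ b p → ⟪ φ ⟫ (keep b p) ≡ ⟪ (λ m → if b m then φ m else 0ℚ) ⟫ p
⟪⟫-keep φ b []            = refl
⟪⟫-keep φ b ((c , m) ∷ p) with b m
... | true  = cong (c ℚ.* φ m ℚ.+_) (⟪⟫-keep φ b p)
... | false = trans (⟪⟫-keep φ b p)
  (trans (sym (ℚ.+-identityˡ _)) (cong (ℚ._+ ⟪ _ ⟫ p) (sym (ℚ.*-zeroʳ c))))

Respectsᵇ : (Mono → Bool) → Set
Respectsᵇ b = ∀ m m' → m ≐ m' → b m ≡ b m'

coeff-keep : ∀ b → Respectsᵇ b → ∀ p m → coeff (keep b p) m ≡ (if b m then coeff p m else 0ℚ)
coeff-keep b b-resp p m = begin
  coeff (keep b p) m                                 ≡⟨ coeff≡⟪indicator⟫ (keep b p) m ⟩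
  ⟪ indicator m ⟫ (keep b p)                         ≡⟨ ⟪⟫-keep _ b p ⟩
  ⟪ (λ l → if b l then indicator m l else 0ℚ) ⟫ p    ≡⟨ ⟪⟫-cong move p ⟩
  ⟪ (λ l → if b m then indicator m l else 0ℚ) ⟫ p    ≡⟨ pull (b m) ⟩
  (if b m then ⟪ indicator m ⟫ p else 0ℚ)            ≡⟨ cong (if b m then_else 0ℚ) (coeff≡⟪indicator⟫ p m) ⟨
  (if b m then coeff p m else 0ℚ)                    ∎
  where
  open ≡.≡-Reasoning
  move : ∀ l → (if b l then indicator m l else 0ℚ) ≡ (if b m then indicator m l else 0ℚ)
  move l with monoEq l m in eq
  ... | true  = cong (if_then 1ℚ else 0ℚ) (b-resp l m (monoEq⇒≐ l m eq))
  ... | false with b l | b m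
  ...   | true  | true  = refl
  ...   | true  | false = refl
  ...   | false | true  = refl
  ...   | false | false = refl
  pull : ∀ x → ⟪ (λ l → if x then indicator m l else 0ℚ) ⟫ p ≡ (if x then ⟪ indicator m ⟫ p else 0ℚ)
  pull true  = refl
  pull false = ⟪⟫-0 p

keep-cong : ∀ b → Respectsᵇ b → ∀ {p q} → p ≈ q → keep b p ≈ keep b q
keep-cong b b-resp {p} {q} p≈q m = trans (coeff-keep b b-resp p m)
  (trans (cong (if b m then_else 0ℚ) (p≈q m)) (sym (coeff-keep b b-resp q m)))

⟪⟫-partition : ∀ φ b p → ⟪ φ ⟫ p ≡ ⟪ φ ⟫ (keep b p) ℚ.+ ⟪ φ ⟫ (keep (not ∘ b) p)
⟪⟫-partition φ b []            = refl
⟪⟫-partition φ b ((c , m) ∷ p) with b m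
... | true  = trans (cong (c ℚ.* φ m ℚ.+_) (⟪⟫-partition φ b p)) (sym (ℚ.+-assoc (c ℚ.* φ m) _ _))
... | false = trans (cong (c ℚ.* φ m ℚ.+_) (⟪⟫-partition φ b p)) (rearrange (c ℚ.* φ m) (⟪ φ ⟫ (keep b p)) _)
  where
  rearrange : ∀ x y z → x ℚ.+ (y ℚ.+ z) ≡ y ℚ.+ (x ℚ.+ z)
  rearrange = solve-∀ ℚ-ring

⟪⟫-constant : ∀ φ b v → (∀ m → b m ≡ true → φ m ≡ v) → ∀ p →
              ⟪ φ ⟫ (keep b p) ≡ ⟪ (λ m → if b m then 1ℚ else 0ℚ) ⟫ p ℚ.* v
⟪⟫-constant φ b v φ≡v []            = sym (ℚ.*-zeroˡ v)
⟪⟫-constant φ b v φ≡v ((c , m) ∷ p) with b m in eq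
... | true  = begin
  c ℚ.* φ m ℚ.+ ⟪ φ ⟫ (keep b p)   ≡⟨ cong₂ (λ x y → c ℚ.* x ℚ.+ y) (φ≡v m eq) (⟪⟫-constant φ b v φ≡v p) ⟩
  c ℚ.* v ℚ.+ u ℚ.* v             ≡⟨ cong (λ x → x ℚ.* v ℚ.+ u ℚ.* v) (ℚ.*-identityʳ c) ⟨
  c ℚ.* 1ℚ ℚ.* v ℚ.+ u ℚ.* v      ≡⟨ ℚ.*-distribʳ-+ v (c ℚ.* 1ℚ) u ⟨
  (c ℚ.* 1ℚ ℚ.+ u) ℚ.* v          ∎
  where
  open ≡.≡-Reasoning
  u = ⟪ (λ m → if b m then 1ℚ else 0ℚ) ⟫ p
... | false = trans (⟪⟫-constant φ b v φ≡v p) (cong (ℚ._* v) (sym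
  (trans (cong (ℚ._+ ⟪ (λ m → if b m then 1ℚ else 0ℚ) ⟫ p) (ℚ.*-zeroʳ c)) (ℚ.+-identityˡ (⟪ (λ m → if b m then 1ℚ else 0ℚ) ⟫ p)))))

-- Induction on the number of terms: the terms sharing the first monomial
-- have coefficients adding up to zero and can be removed together.
≈0⇒⟪⟫≡0 : ∀ φ → Respects≐ φ → ∀ k p → length p ≤ k → p ≈ 𝟘 → ⟪ φ ⟫ p ≡ 0ℚ
≈0⇒⟪⟫≡0 φ φ-resp k       []              _         _   = refl
≈0⇒⟪⟫≡0 φ φ-resp (suc k) p@((c , m) ∷ p') (s≤s len) p≈0 = begin
  ⟪ φ ⟫ p                                          ≡⟨ ⟪⟫-partition φ same p ⟩
  ⟪ φ ⟫ (keep same p) ℚ.+ ⟪ φ ⟫ (keep other p)     ≡⟨ cong₂ ℚ._+_ same≡0 other≡0 ⟩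
  0ℚ                                               ∎
  where
  open ≡.≡-Reasoning
  same other : Mono → Bool
  same l  = monoEq l m
  other l = not (same l)
  other-resp : Respectsᵇ other
  other-resp l l' eq = cong not (monoEq-cong l m l' m eq (λ _ → refl))
  same≡0 : ⟪ φ ⟫ (keep same p) ≡ 0ℚ
  same≡0 = trans (⟪⟫-constant φ same (φ m) (λ l eq → φ-resp l m (monoEq⇒≐ l m eq)) p)
    (trans (cong (ℚ._* φ m) (trans (sym (coeff≡⟪indicator⟫ p m)) (p≈0 m))) (ℚ.*-zeroˡ (φ m)))
  -- The first term passes the test `same`, so at least this term is gone.
  shorter : length (keep other p) ≤ k
  shorter rewrite ≐⇒monoEq m m (λ _ → refl) = ℕ.≤-trans (length-keep other p') len
  other≡0 : ⟪ φ ⟫ (keep other p) ≡ 0ℚ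
  other≡0 = ≈0⇒⟪⟫≡0 φ φ-resp k (keep other p) shorter (keep-cong other other-resp {p} {[]} p≈0)

≈⇒⟪⟫≡ : ∀ φ → Respects≐ φ → ∀ p q → p ≈ q → ⟪ φ ⟫ p ≡ ⟪ φ ⟫ q
≈⇒⟪⟫≡ φ φ-resp p q p≈q = begin
  ⟪ φ ⟫ p                                      ≡⟨ rearrange _ (⟪ φ ⟫ q) ⟩
  ⟪ φ ⟫ p ℚ.+ (ℚ.- 1ℚ) ℚ.* ⟪ φ ⟫ q ℚ.+ ⟪ φ ⟫ q ≡⟨ cong (ℚ._+ ⟪ φ ⟫ q) difference ⟩
  0ℚ ℚ.+ ⟪ φ ⟫ q                               ≡⟨ ℚ.+-identityˡ _ ⟩
  ⟪ φ ⟫ q                                      ∎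
  where
  open ≡.≡-Reasoning
  rearrange : ∀ x y → x ≡ x ℚ.+ (ℚ.- 1ℚ) ℚ.* y ℚ.+ y
  rearrange = solve-∀ ℚ-ring
  cancel : ∀ x → x ℚ.+ (ℚ.- 1ℚ) ℚ.* x ≡ 0ℚ
  cancel = solve-∀ ℚ-ring
  p-q≈0 : p ⊕ neg q ≈ 𝟘
  p-q≈0 m = trans (coeff-⊕ p (neg q) m)
    (trans (cong₂ ℚ._+_ (p≈q m) (coeff-scale (ℚ.- 1ℚ) q m)) (cancel (coeff q m)))
  difference : ⟪ φ ⟫ p ℚ.+ (ℚ.- 1ℚ) ℚ.* ⟪ φ ⟫ q ≡ 0ℚ
  difference = trans (sym (trans (⟪⟫-⊕ φ p (neg q)) (cong (⟪ φ ⟫ p ℚ.+_) (⟪⟫-scale φ (ℚ.- 1ℚ) q))))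
    (≈0⇒⟪⟫≡0 φ φ-resp _ (p ⊕ neg q) ℕ.≤-refl p-q≈0)

⟪⟫≡⇒≈ : ∀ p q → (∀ φ → Respects≐ φ → ⟪ φ ⟫ p ≡ ⟪ φ ⟫ q) → p ≈ q
⟪⟫≡⇒≈ p q eq m = trans (coeff≡⟪indicator⟫ p m)
  (trans (eq (indicator m) (indicator-respects m)) (sym (coeff≡⟪indicator⟫ q m)))

-- Ring structure of the lists of terms

monoMul-respectsˡ : ∀ {φ} → Respects≐ φ → ∀ q → Respects≐ (λ m → ⟪ (λ m' → φ (monoMul m m')) ⟫ q)
monoMul-respectsˡ φ-resp q l l' eq =
  ⟪⟫-cong (λ m' → φ-resp _ _ (monoMul-cong {l} {l'} {m'} eq (λ _ → refl))) q

monoMul-respectsʳ : ∀ {φ} → Respects≐ φ → ∀ m → Respects≐ (λ m' → φ (monoMul m m'))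
monoMul-respectsʳ φ-resp m l l' eq = φ-resp _ _ (monoMul-cong {m} {m} {l} {l'} (λ _ → refl) eq)

-- With one factor fixed, a functional of the product is a functional of the other factor that still
-- respects `_≐_`, so the factors can be exchanged one at a time.
⊗-cong : ∀ {p p' q q'} → p ≈ p' → q ≈ q' → p ⊗ q ≈ p' ⊗ q'
⊗-cong {p} {p'} {q} {q'} p≈p' q≈q' = ⟪⟫≡⇒≈ (p ⊗ q) (p' ⊗ q') λ φ φ-resp → begin
  ⟪ φ ⟫ (p ⊗ q)                                       ≡⟨ ⟪⟫-⊗ φ p q ⟩
  ⟪ (λ m → ⟪ (λ m' → φ (monoMul m m')) ⟫ q) ⟫ p       ≡⟨ ≈⇒⟪⟫≡ _ (monoMul-respectsˡ φ-resp q) p p' p≈p' ⟩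
  ⟪ (λ m → ⟪ (λ m' → φ (monoMul m m')) ⟫ q) ⟫ p'      ≡⟨ ⟪⟫-cong (λ m → ≈⇒⟪⟫≡ _ (monoMul-respectsʳ φ-resp m) q q' q≈q') p' ⟩
  ⟪ (λ m → ⟪ (λ m' → φ (monoMul m m')) ⟫ q') ⟫ p'     ≡⟨ ⟪⟫-⊗ φ p' q' ⟨
  ⟪ φ ⟫ (p' ⊗ q')                                     ∎
  where open ≡.≡-Reasoning

⊗-comm : ∀ p q → p ⊗ q ≈ q ⊗ p
⊗-comm p q = ⟪⟫≡⇒≈ (p ⊗ q) (q ⊗ p) λ φ _ → begin
  ⟪ φ ⟫ (p ⊗ q)                                       ≡⟨ ⟪⟫-⊗ φ p q ⟩
  ⟪ (λ m → ⟪ (λ m' → φ (monoMul m m')) ⟫ q) ⟫ p       ≡⟨ ⟪⟫-swap _ p q ⟩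
  ⟪ (λ m' → ⟪ (λ m → φ (monoMul m m')) ⟫ p) ⟫ q       ≡⟨ ⟪⟫-cong (λ m' → ⟪⟫-cong (λ m → cong φ (monoMul-comm m m')) p) q ⟩
  ⟪ (λ m' → ⟪ (λ m → φ (monoMul m' m)) ⟫ p) ⟫ q       ≡⟨ ⟪⟫-⊗ φ q p ⟨
  ⟪ φ ⟫ (q ⊗ p)                                       ∎
  where open ≡.≡-Reasoning

⊗-assoc : ∀ p q r → (p ⊗ q) ⊗ r ≈ p ⊗ (q ⊗ r)
⊗-assoc p q r = ⟪⟫≡⇒≈ ((p ⊗ q) ⊗ r) (p ⊗ (q ⊗ r)) λ φ _ → begin
  ⟪ φ ⟫ ((p ⊗ q) ⊗ r)
    ≡⟨ ⟪⟫-⊗ φ (p ⊗ q) r ⟩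
  ⟪ (λ m → ⟪ (λ n → φ (monoMul m n)) ⟫ r) ⟫ (p ⊗ q)
    ≡⟨ ⟪⟫-⊗ _ p q ⟩
  ⟪ (λ l → ⟪ (λ m → ⟪ (λ n → φ (monoMul (monoMul l m) n)) ⟫ r) ⟫ q) ⟫ p
    ≡⟨ ⟪⟫-cong (λ l → ⟪⟫-cong (λ m → ⟪⟫-cong (λ n → cong φ (monoMul-assoc l m n)) r) q) p ⟩
  ⟪ (λ l → ⟪ (λ m → ⟪ (λ n → φ (monoMul l (monoMul m n))) ⟫ r) ⟫ q) ⟫ p
    ≡⟨ ⟪⟫-cong (λ l → ⟪⟫-⊗ (λ m → φ (monoMul l m)) q r) p ⟨
  ⟪ (λ l → ⟪ (λ m → φ (monoMul l m)) ⟫ (q ⊗ r)) ⟫ p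
    ≡⟨ ⟪⟫-⊗ φ p (q ⊗ r) ⟨
  ⟪ φ ⟫ (p ⊗ (q ⊗ r))
    ∎
  where open ≡.≡-Reasoning

⊗-identityˡ : ∀ p → 𝟙 ⊗ p ≈ p
⊗-identityˡ p = ⟪⟫≡⇒≈ (𝟙 ⊗ p) p λ φ _ →
  trans (⟪⟫-⊗ φ 𝟙 p) (trans (ℚ.+-identityʳ _) (ℚ.*-identityˡ _))

⊗-distribʳ-⊕ : ∀ r p q → (p ⊕ q) ⊗ r ≈ p ⊗ r ⊕ q ⊗ r
⊗-distribʳ-⊕ r p q = ⟪⟫≡⇒≈ ((p ⊕ q) ⊗ r) (p ⊗ r ⊕ q ⊗ r) λ φ _ → begin
  ⟪ φ ⟫ ((p ⊕ q) ⊗ r)                  ≡⟨ ⟪⟫-⊗ φ (p ⊕ q) r ⟩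
  ⟪ _ ⟫ (p ⊕ q)                        ≡⟨ ⟪⟫-⊕ _ p q ⟩
  ⟪ _ ⟫ p ℚ.+ ⟪ _ ⟫ q                  ≡⟨ cong₂ ℚ._+_ (⟪⟫-⊗ φ p r) (⟪⟫-⊗ φ q r) ⟨
  ⟪ φ ⟫ (p ⊗ r) ℚ.+ ⟪ φ ⟫ (q ⊗ r)      ≡⟨ ⟪⟫-⊕ φ (p ⊗ r) (q ⊗ r) ⟨
  ⟪ φ ⟫ (p ⊗ r ⊕ q ⊗ r)                ∎
  where open ≡.≡-Reasoning

⊕-cong : ∀ {p p' q q'} → p ≈ p' → q ≈ q' → p ⊕ q ≈ p' ⊕ q'
⊕-cong {p} {p'} {q} {q'} p≈p' q≈q' m =
  trans (coeff-⊕ p q m) (trans (cong₂ ℚ._+_ (p≈p' m) (q≈q' m)) (sym (coeff-⊕ p' q' m)))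

⊕-comm : ∀ p q → p ⊕ q ≈ q ⊕ p
⊕-comm p q m = trans (coeff-⊕ p q m) (trans (ℚ.+-comm (coeff p m) _) (sym (coeff-⊕ q p m)))

⊕-inverseʳ : ∀ p → p ⊕ neg p ≈ 𝟘
⊕-inverseʳ p m = trans (coeff-⊕ p (neg p) m) (trans (cong (coeff p m ℚ.+_) (coeff-scale (ℚ.- 1ℚ) p m)) (cancel (coeff p m)))
  where
  cancel : ∀ x → x ℚ.+ (ℚ.- 1ℚ) ℚ.* x ≡ 0ℚ
  cancel = solve-∀ ℚ-ring

≈-trans : ∀ p q r → p ≈ q → q ≈ r → p ≈ r
≈-trans p q r p≈q q≈r m = trans (p≈q m) (q≈r m)

SymQT-ring : CommutativeRing 0ℓ 0ℓ
SymQT-ring = record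
  { Carrier = SymQT ; _≈_ = _≈_ ; _+_ = _⊕_ ; _*_ = _⊗_ ; -_ = neg ; 0# = 𝟘 ; 1# = 𝟙
  ; isCommutativeRing = record
    { isRing = record
      { +-isAbelianGroup = record
        { isGroup = record
          { isMonoid = record
            { isSemigroup = record
              { isMagma = record
                { isEquivalence = record
                  { refl = λ _ → refl ; sym = λ eq m → sym (eq m) ; trans = λ {p} {q} {r} → ≈-trans p q r }
                ; ∙-cong = λ {p} {p'} {q} {q'} → ⊕-cong {p} {p'} {q} {q'} }
              ; assoc = λ p q r m → cong (λ x → coeff x m) (++-assoc p q r) }
            ; identity = (λ _ _ → refl) , (λ p m → cong (λ x → coeff x m) (++-identityʳ p)) }
          ; inverse = (λ p → ≈-trans (neg p ⊕ p) (p ⊕ neg p) 𝟘 (⊕-comm (neg p) p) (⊕-inverseʳ p)) , ⊕-inverseʳ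
          ; ⁻¹-cong = λ {p} {q} eq m → trans (coeff-scale (ℚ.- 1ℚ) p m) (trans (cong (ℚ.- 1ℚ ℚ.*_) (eq m)) (sym (coeff-scale (ℚ.- 1ℚ) q m))) }
        ; comm = ⊕-comm }
      ; *-cong = λ {p} {p'} {q} {q'} → ⊗-cong {p} {p'} {q} {q'}
      ; *-assoc = ⊗-assoc
      ; *-identity = ⊗-identityˡ , (λ p → ≈-trans (p ⊗ 𝟙) (𝟙 ⊗ p) p (⊗-comm p 𝟙) (⊗-identityˡ p))
      ; distrib = (λ r p q → ≈-trans (r ⊗ (p ⊕ q)) ((p ⊕ q) ⊗ r) (r ⊗ p ⊕ r ⊗ q) (⊗-comm r (p ⊕ q))
                     (≈-trans ((p ⊕ q) ⊗ r) (p ⊗ r ⊕ q ⊗ r) (r ⊗ p ⊕ r ⊗ q) (⊗-distribʳ-⊕ r p q)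
                       (⊕-cong {p ⊗ r} {r ⊗ p} {q ⊗ r} {r ⊗ q} (⊗-comm p r) (⊗-comm q r))))
                , ⊗-distribʳ-⊕ }
    ; *-comm = ⊗-comm } }

-- The grading by degree in the eⱼ

mutual
  -- The local function in the definition of degE, recovered by unification.
  degTail : ℕ → ℕ → List ℕ → ℕ → List ℕ → ℕ
  degTail = _

  degE-cons : ∀ x y k ks → degE (x ∷ y ∷ k ∷ ks) ≡ k ℕ.+ 0 ℕ.+ degTail x y (k ∷ ks) 2 ks
  -- Once the compound arguments are variables, the unknown is applied to distinct variables and
  -- unification has a unique solution.
  degE-cons x y k ks with k ∷ ks | 2
  ... | l | i = refl

weight : ℕ → List ℕ → ℕ
weight i []       = 0
weight i (k ∷ ks) = i ℕ.* k ℕ.+ weight (suc i) ks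

degTail≡weight : ∀ x y l i ks → degTail x y l i ks ≡ weight i ks
degTail≡weight x y l i []       = refl
degTail≡weight x y l i (k ∷ ks) = cong (i ℕ.* k ℕ.+_) (degTail≡weight x y l (suc i) ks)

degE≡weight : ∀ x y ks → degE (x ∷ y ∷ ks) ≡ weight 1 ks
degE≡weight x y ks = degTail≡weight x y ks 1 ks

weight-respects : ∀ i m m' → m ≐ m' → weight i m ≡ weight i m'
weight-respects i []      []       eq = refl
weight-respects i []      (y ∷ m') eq rewrite sym (eq 0) | ℕ.*-zeroʳ i =
  weight-respects (suc i) [] m' (eq ∘ suc)
weight-respects i (x ∷ m) []       eq rewrite eq 0 | ℕ.*-zeroʳ i =
  weight-respects (suc i) m [] (eq ∘ suc)
weight-respects i (x ∷ m) (y ∷ m') eq =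
  cong₂ (λ u v → i ℕ.* u ℕ.+ v) (eq 0) (weight-respects (suc i) m m' (eq ∘ suc))

degE-respects : ∀ m m' → m ≐ m' → degE m ≡ degE m'
degE-respects m m' eq = begin
  degE m                     ≡⟨ degE≡ m ⟩
  weight 1 (dropTwo m)       ≡⟨ weight-respects 1 (dropTwo m) (dropTwo m') tail≐ ⟩
  weight 1 (dropTwo m')      ≡⟨ degE≡ m' ⟨
  degE m'                    ∎
  where
  open ≡.≡-Reasoning
  dropTwo : Mono → List ℕ
  dropTwo (_ ∷ _ ∷ ks) = ks
  dropTwo _            = []
  degE≡ : ∀ m → degE m ≡ weight 1 (dropTwo m)
  degE≡ []           = refl
  degE≡ (x ∷ [])     = refl
  degE≡ (x ∷ y ∷ ks) = degE≡weight x y ks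
  exponent-dropTwo : ∀ m i → exponent (dropTwo m) i ≡ exponent m (suc (suc i))
  exponent-dropTwo []           i = refl
  exponent-dropTwo (x ∷ [])     i = refl
  exponent-dropTwo (x ∷ y ∷ ks) i = refl
  tail≐ : dropTwo m ≐ dropTwo m'
  tail≐ i = trans (exponent-dropTwo m i) (trans (eq _) (sym (exponent-dropTwo m' i)))

weight-monoMul : ∀ i m m' → weight i (monoMul m m') ≡ weight i m ℕ.+ weight i m'
weight-monoMul i []      m'       = refl
weight-monoMul i (x ∷ m) []       = sym (ℕ.+-identityʳ _)
weight-monoMul i (x ∷ m) (y ∷ m') = begin
  i ℕ.* (x ℕ.+ y) ℕ.+ weight (suc i) (monoMul m m')
    ≡⟨ cong₂ ℕ._+_ (ℕ.*-distribˡ-+ i x y) (weight-monoMul (suc i) m m') ⟩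
  (i ℕ.* x ℕ.+ i ℕ.* y) ℕ.+ (weight (suc i) m ℕ.+ weight (suc i) m')
    ≡⟨ interchange (i ℕ.* x) _ _ _ ⟩
  (i ℕ.* x ℕ.+ weight (suc i) m) ℕ.+ (i ℕ.* y ℕ.+ weight (suc i) m')
    ∎
  where open ≡.≡-Reasoning

degE-monoMul : ∀ m m' → degE (monoMul m m') ≡ degE m ℕ.+ degE m'
degE-monoMul []           m'             = refl
degE-monoMul (x ∷ [])     []             = refl
degE-monoMul (x ∷ y ∷ ks) []             = sym (ℕ.+-identityʳ _)
degE-monoMul (x ∷ [])     (x' ∷ [])      = refl
degE-monoMul (x ∷ [])     (x' ∷ y' ∷ ls) =
  trans (degE≡weight (x ℕ.+ x') y' ls) (sym (degE≡weight x' y' ls))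
degE-monoMul (x ∷ y ∷ ks) (x' ∷ [])      =
  trans (degE≡weight (x ℕ.+ x') y ks) (trans (sym (degE≡weight x y ks)) (sym (ℕ.+-identityʳ _)))
degE-monoMul (x ∷ y ∷ ks) (x' ∷ y' ∷ ls) =
  trans (degE≡weight (x ℕ.+ x') (y ℕ.+ y') (monoMul ks ls))
    (trans (weight-monoMul 1 ks ls) (cong₂ ℕ._+_ (sym (degE≡weight x y ks)) (sym (degE≡weight x' y' ls))))

-- A strict bound, so that `trunc d` is `tr (suc d)` and `tr 0` kills everything, as the empty word
-- requires in `conv-high`.
below : ℕ → Mono → Bool
below zero    m = false
below (suc d) m = degE m ≤ᵇ d

below-respects : ∀ n → Respectsᵇ (below n)
below-respects zero    m m' eq = refl
below-respects (suc d) m m' eq = cong (_≤ᵇ d) (degE-respects m m' eq)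

below⇒< : ∀ n m → below n m ≡ true → degE m < n
below⇒< (suc d) m eq = s≤s (ℕ.≤ᵇ⇒≤ _ _ (Equivalence.from T-≡ eq))

<⇒below : ∀ n m → degE m < n → below n m ≡ true
<⇒below (suc d) m (s≤s lt) = Equivalence.to T-≡ (ℕ.≤⇒≤ᵇ lt)

≥⇒below : ∀ n m → n ≤ degE m → below n m ≡ false
≥⇒below n m ge with below n m in eq
... | false = refl
... | true  = contradiction (below⇒< n m eq) (ℕ.≤⇒≯ ge)

tr : ℕ → SymQT → SymQT
tr n = keep (below n)

trunc≡tr : ∀ d p → trunc d p ≡ tr (suc d) p
trunc≡tr d []            = refl
trunc≡tr d ((c , m) ∷ p) with degE m ≤ᵇ d
... | true  = cong (_ ∷_) (trunc≡tr d p)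
... | false = trunc≡tr d p

All-Mono : (Mono → Set) → SymQT → Set
All-Mono P = All (λ x → P (proj₂ x))

keep-all : ∀ b p → All-Mono (λ m → b m ≡ true) p → keep b p ≡ p
keep-all b []      []         = refl
keep-all b (_ ∷ p) (eq ∷ eqs) rewrite eq = cong (_ ∷_) (keep-all b p eqs)

keep-none : ∀ b p → All-Mono (λ m → b m ≡ false) p → keep b p ≡ []
keep-none b []      []         = refl
keep-none b (_ ∷ p) (eq ∷ eqs) rewrite eq = keep-none b p eqs

All-keep : ∀ b p → All-Mono (λ m → b m ≡ true) (keep b p)
All-keep b []            = []
All-keep b ((c , m) ∷ p) with b m in eq
... | true  = eq ∷ All-keep b p
... | false = All-keep b p

All-⊗ : ∀ {P Q S} → (∀ m m' → P m → Q m' → S (monoMul m m')) →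
        ∀ p q → All-Mono P p → All-Mono Q q → All-Mono S (p ⊗ q)
All-⊗ f []            q []        qs = []
All-⊗ f ((c , m) ∷ p) q (Pm ∷ ps) qs =
  All.++⁺ (All.map⁺ (All.map (λ {x} → f m (proj₂ x) Pm) qs)) (All-⊗ f p q ps qs)

tr-cong : ∀ n {p q} → p ≈ q → tr n p ≈ tr n q
tr-cong n {p} {q} = keep-cong (below n) (below-respects n) {p} {q}

keep-++ : ∀ b p q → keep b (p ++ q) ≡ keep b p ++ keep b q
keep-++ b []            q = refl
keep-++ b ((c , m) ∷ p) q with b m
... | true  = cong (_ ∷_) (keep-++ b p q)
... | false = keep-++ b p q

≡⇒≈ : ∀ {p q} → p ≡ q → p ≈ q
≡⇒≈ refl m = refl

tr-⊕ : ∀ n p q → tr n (p ⊕ q) ≈ tr n p ⊕ tr n q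
tr-⊕ n p q = ≡⇒≈ (keep-++ (below n) p q)

tr-idem : ∀ n p → tr n (tr n p) ≈ tr n p
tr-idem n p = ≡⇒≈ (keep-all (below n) (tr n p) (All-keep (below n) p))

-- The hypotheses allow p and q to contain terms of high degree that cancel. Their truncations are
-- equal to them as polynomials and are low term by term, so the degrees of the product can be read
-- off its terms.
tr-low-⊗ : ∀ a b p q → tr (suc a) p ≈ p → tr (suc b) q ≈ q → tr (suc (a ℕ.+ b)) (p ⊗ q) ≈ p ⊗ q
tr-low-⊗ a b p q p-low q-low m = begin
  coeff (tr (suc (a ℕ.+ b)) (p ⊗ q)) m
    ≡⟨ tr-cong (suc (a ℕ.+ b)) {p ⊗ q} {p' ⊗ q'} p⊗q≈ m ⟩
  coeff (tr (suc (a ℕ.+ b)) (p' ⊗ q')) m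
    ≡⟨ cong (λ x → coeff x m) (keep-all _ (p' ⊗ q') all-below) ⟩
  coeff (p' ⊗ q') m
    ≡⟨ p⊗q≈ m ⟨
  coeff (p ⊗ q) m
    ∎
  where
  open ≡.≡-Reasoning
  p' = tr (suc a) p
  q' = tr (suc b) q
  p⊗q≈ : p ⊗ q ≈ p' ⊗ q'
  p⊗q≈ = ⊗-cong {p} {p'} {q} {q'} (sym ∘ p-low) (sym ∘ q-low)
  all-below : All-Mono (λ l → below (suc (a ℕ.+ b)) l ≡ true) (p' ⊗ q')
  all-below = All-⊗ (λ l l' eq eq' → <⇒below (suc (a ℕ.+ b)) (monoMul l l') (subst (_< suc (a ℕ.+ b)) (sym (degE-monoMul l l'))
      (s≤s (ℕ.+-mono-≤ (s≤s⁻¹ (below⇒< (suc a) l eq)) (s≤s⁻¹ (below⇒< (suc b) l' eq'))))))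
    p' q' (All-keep _ p) (All-keep _ q)

-- As for low degrees: each factor is replaced by its terms of degree at least the bound, the rest
-- being zero as a polynomial.
tr-high-⊗ : ∀ a b p q → tr a p ≈ 𝟘 → tr b q ≈ 𝟘 → tr (a ℕ.+ b) (p ⊗ q) ≈ 𝟘
tr-high-⊗ a b p q p-high q-high m =
  trans (tr-cong (a ℕ.+ b) {p ⊗ q} {p' ⊗ q'} (⊗-cong {p} {p'} {q} {q'} (upper a p p-high) (upper b q q-high)) m)
    (cong (λ x → coeff x m) (keep-none _ (p' ⊗ q') none-below))
  where
  above : ℕ → Mono → Bool
  above n = not ∘ below n
  p' = keep (above a) p
  q' = keep (above b) q
  upper : ∀ n p → tr n p ≈ 𝟘 → p ≈ keep (above n) p
  upper n p p-high = ⟪⟫≡⇒≈ p (keep (above n) p) λ φ φ-resp →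
    trans (⟪⟫-partition φ (below n) p)
      (trans (cong (ℚ._+ ⟪ φ ⟫ (keep (above n) p)) (≈⇒⟪⟫≡ φ φ-resp (tr n p) 𝟘 p-high)) (ℚ.+-identityˡ _))
  above⇒≥ : ∀ n m → above n m ≡ true → n ≤ degE m
  above⇒≥ n m eq = ℕ.≮⇒≥ λ lt → contradiction (trans (sym (cong not (<⇒below n m lt))) eq) λ ()
  none-below : All-Mono (λ l → below (a ℕ.+ b) l ≡ false) (p' ⊗ q')
  none-below = All-⊗ (λ l l' eq eq' → ≥⇒below (a ℕ.+ b) (monoMul l l') (subst (a ℕ.+ b ≤_) (sym (degE-monoMul l l'))
      (ℕ.+-mono-≤ (above⇒≥ a l eq) (above⇒≥ b l' eq'))))
    p' q' (All-keep _ p) (All-keep _ q)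

tr-low-mono : ∀ {a b} p → a ≤ b → tr a p ≈ p → tr b p ≈ p
tr-low-mono {a} {b} p a≤b p-low m = begin
  coeff (tr b p) m          ≡⟨ tr-cong b {tr a p} {p} p-low m ⟨
  coeff (tr b (tr a p)) m   ≡⟨ cong (λ x → coeff x m) (keep-all _ (tr a p) (All.map (λ {x} → bound {x}) (All-keep _ p))) ⟩
  coeff (tr a p) m          ≡⟨ p-low m ⟩
  coeff p m                 ∎
  where
  open ≡.≡-Reasoning
  bound : ∀ {x : ℚ × Mono} → below a (proj₂ x) ≡ true → below b (proj₂ x) ≡ true
  bound {x} eq = <⇒below b (proj₂ x) (ℕ.≤-trans (below⇒< a (proj₂ x) eq) a≤b)

-- The series σ

mutual
  -- The private function in the definition of hsRev, recovered by unification.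
  hStep : ℕ → List SymQT → SymQT
  hStep = _

  hsRev-suc : ∀ k → hsRev (suc k) ≡ hStep 0 (hsRev k) ∷ hsRev k
  hsRev-suc k with hsRev k | 0
  ... | l | i = refl

High : ℕ → SymQT → Set
High n = All-Mono (λ m → n ≤ degE m)

High-⊗ : ∀ a b p q → High a p → High b q → High (a ℕ.+ b) (p ⊗ q)
High-⊗ a b = All-⊗ λ m m' a≤ b≤ → subst (_ ≤_) (sym (degE-monoMul m m')) (ℕ.+-mono-≤ a≤ b≤)

High-0 : ∀ p → High 0 p
High-0 p = All.universal (λ _ → z≤n) p

High-e : ∀ i → High (suc i) (e (suc i))
High-e i = ℕ.≤-reflexive (sym (trans (degE≡weight 0 0 (replicate i 0 ++ 1 ∷ [])) (weight-var 1 i))) ∷ []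
  where
  weight-var : ∀ j i → weight j (replicate i 0 ++ 1 ∷ []) ≡ j ℕ.+ i
  weight-var j zero    = trans (ℕ.+-identityʳ (j ℕ.* 1)) (trans (ℕ.*-identityʳ j) (sym (ℕ.+-identityʳ j)))
  weight-var j (suc i) rewrite ℕ.*-zeroʳ j = trans (weight-var (suc j) i) (sym (ℕ.+-suc j i))

HighDescending : ℕ → List SymQT → Set
HighDescending k []       = Unit.⊤
HighDescending k (h ∷ hs) = High k h × HighDescending (ℕ.pred k) hs

-- Along the list the index of e grows by one while the degree of h falls by one, so every summand
-- obeys the same bound.
High-hStep : ∀ i k hs → HighDescending k hs → High (suc (i ℕ.+ k)) (hStep i hs)
High-hStep i k []       _            = []
High-hStep i k (h ∷ hs) (h-high , hs-high) = All.++⁺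
  (High-⊗ (suc i) k (sign i ⊗ e (suc i)) h (High-⊗ 0 (suc i) (sign i) (e (suc i)) (High-0 (sign i)) (High-e i)) h-high)
  (All.map (ℕ.≤-trans (bound k)) (High-hStep (suc i) (ℕ.pred k) hs hs-high))
  where
  -- At k = 0 the predecessor stays 0, and the bound on the tail is one stronger than needed.
  bound : ∀ k → suc (i ℕ.+ k) ≤ suc (suc i ℕ.+ ℕ.pred k)
  bound zero    = ℕ.n≤1+n _
  bound (suc k) = ℕ.≤-reflexive (cong suc (ℕ.+-suc i k))

hsRev-high : ∀ k → HighDescending k (hsRev k)
hsRev-high zero    = High-0 𝟙 , Unit.tt
hsRev-high (suc k) = High-hStep 0 k (hsRev k) (hsRev-high k) , hsRev-high k

s-high : ∀ k → High k (s k)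
s-high k with hsRev k | hsRev-high k
... | []    | _          = []
... | _ ∷ _ | h-high , _ = h-high

-- Every summand added beyond `σ≤ d` is some s D with D > d, and all its terms have degree at least
-- D.
tr-σ≤ : ∀ d k → tr (suc d) (σ≤ (k ℕ.+ d)) ≈ tr (suc d) (σ≤ d)
tr-σ≤ d zero    m = refl
tr-σ≤ d (suc k) m = begin
  coeff (tr (suc d) (σ≤ (k ℕ.+ d) ⊕ s D)) m
    ≡⟨ cong (λ x → coeff x m) (keep-++ _ (σ≤ (k ℕ.+ d)) (s D)) ⟩
  coeff (tr (suc d) (σ≤ (k ℕ.+ d)) ⊕ tr (suc d) (s D)) m
    ≡⟨ cong (λ x → coeff (tr (suc d) (σ≤ (k ℕ.+ d)) ⊕ x) m) (keep-none _ (s D) (All.map (λ {x} → high {x}) (s-high D))) ⟩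
  coeff (tr (suc d) (σ≤ (k ℕ.+ d)) ⊕ []) m
    ≡⟨ cong (λ x → coeff x m) (++-identityʳ (tr (suc d) (σ≤ (k ℕ.+ d)))) ⟩
  coeff (tr (suc d) (σ≤ (k ℕ.+ d))) m
    ≡⟨ tr-σ≤ d k m ⟩
  coeff (tr (suc d) (σ≤ d)) m
    ∎
  where
  open ≡.≡-Reasoning
  D = suc k ℕ.+ d
  high : ∀ {x : ℚ × Mono} → D ≤ degE (proj₂ x) → below (suc d) (proj₂ x) ≡ false
  high {x} D≤ = ≥⇒below (suc d) (proj₂ x) (ℕ.≤-trans (s≤s (ℕ.m≤n+m d k)) D≤)

tr-isTruncation : IsTruncation SymQT-ring tr
tr-isTruncation = record
  { tr-cong = λ n {p} {q} → tr-cong n {p} {q} ; tr-+ = tr-⊕ ; tr-idem = tr-idem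
  ; tr-zero = λ p → ≡⇒≈ (keep-zero p) ; tr-low-mono = tr-low-mono
  ; tr-low-* = tr-low-⊗ ; tr-high-* = tr-high-⊗ }
  where
  keep-zero : ∀ p → tr 0 p ≡ 𝟘
  keep-zero []      = ≡.refl
  keep-zero (_ ∷ p) = keep-zero p

-- Inverse factorials among the rational constants

module ℚ-Sums = Sums ℚ.+-*-commutativeRing
module Sym-Sums = Sums SymQT-ring

const : ℚ → SymQT
const c = (c , []) ∷ []

const-+ : ∀ c d → const c ⊕ const d ≈ const (c ℚ.+ d)
const-+ c d m with monoEq [] m
... | true  = ≡.sym (ℚ.+-assoc c d 0ℚ)
... | false = ≡.refl

fromℕ : ℕ → ℚ
fromℕ k = k ℚ-Sums.× 1ℚ

fromℕ-nonNeg : ∀ k → ℚ.NonNegative (fromℕ k)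
fromℕ-nonNeg zero    = _
fromℕ-nonNeg (suc k) = ℚ.nonNeg+nonNeg⇒nonNeg 1ℚ (fromℕ k) {{fromℕ-nonNeg k}}

fromℕ-nonZero : ∀ k → .{{ℕ.NonZero k}} → ℚ.NonZero (fromℕ k)
fromℕ-nonZero (suc k) = ℚ.pos⇒nonZero (fromℕ (suc k)) {{ℚ.pos+nonNeg⇒pos 1ℚ (fromℕ k) {{fromℕ-nonNeg k}}}}

×-const : ∀ k c → k Sym-Sums.× const c ≈ const (fromℕ k ℚ.* c)
×-const zero    c m with monoEq [] m
... | true  = ≡.sym (≡.trans (ℚ.+-identityʳ _) (ℚ.*-zeroˡ c))
... | false = ≡.refl
×-const (suc k) c m = begin
  coeff (const c ⊕ k Sym-Sums.× const c) m
    ≡⟨ ⊕-cong {const c} {const c} {k Sym-Sums.× const c} {const (fromℕ k ℚ.* c)} (λ _ → ≡.refl) (×-const k c) m ⟩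
  coeff (const c ⊕ const (fromℕ k ℚ.* c)) m
    ≡⟨ const-+ c (fromℕ k ℚ.* c) m ⟩
  coeff (const (c ℚ.+ fromℕ k ℚ.* c)) m
    ≡⟨ cong (λ x → coeff (const x) m) (≡.trans (cong (ℚ._+ fromℕ k ℚ.* c) (≡.sym (ℚ.*-identityˡ c))) (≡.sym (ℚ.*-distribʳ-+ c 1ℚ (fromℕ k)))) ⟩
  coeff (const (fromℕ (suc k) ℚ.* c)) m
    ∎
  where open ≡.≡-Reasoning

factorial-nonZero : ∀ k → ℚ.NonZero (fromℕ (k !))
factorial-nonZero k = fromℕ-nonZero (k !) {{ℕ._!≢0 k}}

inverseFactorial : ℕ → SymQT
inverseFactorial k = const (ℚ.1/_ (fromℕ (k !)) {{factorial-nonZero k}})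

inverseFactorial-inverse : Characters.IsInverseFactorial SymQT-ring inverseFactorial
inverseFactorial-inverse k m = ≡.trans (×-const (k !) _ m)
  (cong (λ c → coeff (const c) m) (ℚ.*-inverseʳ (fromℕ (k !)) {{factorial-nonZero k}}))

open Homomorphism SymQT-ring tr tr-isTruncation σ≤ tr-σ≤ inverseFactorial inverseFactorial-inverse qv tv

-- Identification with 𝒫, ℋ and 𝒢 as defined

pow≡^ : ∀ p k → pow p k ≡ p Sym-Sums.^ k
pow≡^ p zero    = ≡.refl
pow≡^ p (suc k) = cong (p ⊗_) (pow≡^ p k)

sign≡sgn : ∀ k → sign k ≡ sgn k
sign≡sgn zero    = ≡.refl
sign≡sgn (suc k) = cong neg (sign≡sgn k)

scale-1 : ∀ p → scale 1ℚ p ≡ p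
scale-1 []            = ≡.refl
scale-1 ((c , m) ∷ p) = cong₂ _∷_ (cong (_, m) (ℚ.*-identityˡ c)) (scale-1 p)

extend-basis : ∀ f rs → extend f (map (λ r → (1ℚ , r)) rs) ≡ Sym-Sums.∑ rs f
extend-basis f []       = ≡.refl
extend-basis f (r ∷ rs) = cong₂ _⊕_ (scale-1 (f r)) (extend-basis f rs)

module _ {n : ℕ} (rk : Subset n → ℕ) (rk-isPolymatroid : IsPolymatroid rk) where
  open IsPolymatroid rk-isPolymatroid

  Pfun-∅ : ∀ k A → ∣ A ∣ ≡ 0 → Pfun rk k A ≡ 𝟙
  Pfun-∅ zero    A _  = ≡.refl
  Pfun-∅ (suc k) A eq with ∣ A ∣
  Pfun-∅ (suc k) A ≡.refl | zero = ≡.refl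

  Pfun-suc : ∀ k A d → ∣ A ∣ ≡ suc d → Pfun rk (suc k) A ≡
    tr (suc d) (neg (Sym-Sums.∑ (properSubsets A) λ C → Pfun rk k C ⊗ σ≤ d Sym-Sums.^ (rk A ∸ rk C) ⊗ sgn (suc d ∸ ∣ C ∣)))
  Pfun-suc k A d eq with ∣ A ∣
  Pfun-suc k A d ≡.refl | suc d = ≡.trans (trunc≡tr d (neg (sumP (map term (properSubsets A))))) (cong (tr (suc d) ∘ neg ∘ sumP) (map-cong
    (λ C → cong₂ (λ u v → Pfun rk k C ⊗ u ⊗ v) (pow≡^ (σ≤ d) (rk A ∸ rk C)) (sign≡sgn (suc d ∸ ∣ C ∣)))
    (properSubsets A)))
    where
    term : Subset n → SymQT
    term C = Pfun rk k C ⊗ pow (σ≤ d) (rk A ∸ rk C) ⊗ sign (suc d ∸ ∣ C ∣)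

  Pfun-isRecursive : IsRecursive rk rk-empty rk-monotone (Pfun rk)
  Pfun-isRecursive = record
    { P-∅ = λ k A eq → ≡⇒≈ (Pfun-∅ k A eq) ; P-suc = λ k A d eq → ≡⇒≈ (Pfun-suc k A d eq) }

  τ-𝒢 : extend τ (𝒢 rk) ≈ ℋ rk
  τ-𝒢 m = begin
    coeff (extend τ (𝒢 rk)) m
      ≡⟨ cong (λ p → coeff p m) (extend-basis τ (rseqs rk n ⊥)) ⟩
    coeff (Sym-Sums.∑ (rseqs rk n ⊥) τ) m
      ≡⟨ ∑-τ-rseqs rk rk-empty rk-monotone Pfun-isRecursive m ⟩
    coeff (Sym-Sums.∑ (allSubsets n) (λ A → 𝒫 rk A ⊗ qv Sym-Sums.^ rk A ⊗ tv Sym-Sums.^ ∣ A ∣)) m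
      ≡⟨ cong (λ ps → coeff (sumP ps) m) (map-cong
          (λ A → cong₂ (λ u v → 𝒫 rk A ⊗ u ⊗ v) (pow≡^ qv (rk A)) (pow≡^ tv ∣ A ∣)) (allSubsets n)) ⟨
    coeff (ℋ rk) m
      ∎
    where open ≡.≡-Reasoning

theorem7p6 : Σ (Comp → SymQT) (λ τ → IsAlgHomOnBasis τ × (∀ (n : ℕ) (rk : Subset n → ℕ) → IsPolymatroid rk → extend τ (𝒢 rk) ≈ ℋ rk))
theorem7p6 = τ , record { unital = T.unital ; mult = T.mult } , λ n → τ-𝒢
  where module T = Characters.IsCharacter τ-character
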